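{- Let $q \ge 2$ and $1 \le k \le n$ be integers, let $d$ be an integer with $0 < d \le 2k$, and let $l = k - d/2$. Let $\mathcal{F}$ be an $(n,k,l)_q$-family. If $$|\mathcal{F}| > \max\{\,2l+2,\; 4(k-l)^2 + 2(k-l) + 1,\; q-1\,\},$$ then $l$ is an integer, $\mathcal{F}$ is a $\Delta_q(n,k,l)$-system, and $$|\mathcal{F}| \le \frac{n-l}{k-l}.$$
   Context: $H_q^n = \{0,1,\ldots,q-1\}^n$ is the $q$-ary Hamming space; $x(i)$ denotes the $i$-th coordinate of $x$, $\mathrm{supp}(x) = \{i \in [n] : x(i) \neq 0\}$ with $[n]=\{1,\ldots,n\}$, $\mathrm{wt}(x) = |\mathrm{supp}(x)|$, and $\mathrm{d_H}(x,y) = |\{i \in [n]: x(i) \neq y(i)\}|$. The Johnson space is $J_q^{n,k} = \{x \in H_q^n : \mathrm{wt}(x) = k\}$. For $x,y \in J_q^{n,k}$ the intersection size is defined as $|x \cap y|_q = k - \mathrm{d_H}(x,y)/2$ (possibly a half-integer). An $(n,k,l)_q$-family, with $l = k - d/2$, is an equidistant code $\mathcal{F} \subseteq J_q^{n,k}$ with distance $d$, i.e. $\mathrm{d_H}(x,y) = d$ for all distinct $x,y \in \mathcal{F}$ (equivalently, $|x\cap y|_q = l$ for all distinct $x,y\in\mathcal{F}$). A code $C \subseteq J_q^{n,k}$ is a $\Delta_q(n,k,l)$-system if there is a set $D \subseteq [n]$ (the kernel) with $|D| = l$ such that (1) for any two distinct codewords $x,y \in C$, $x(i) = y(i) \neq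 0$ for all $i \in D$; and (2) the sets $\mathrm{supp}(x) \setminus D$, $x \in C$, are pairwise disjoint. -}

module Defs where

import Algebra.Properties.Group as GroupProperties
open import Data.Bool.Base using (not)
open import Data.Fin.Base using (Fin; toℕ)
import Data.Fin.Properties as Fin
open import Data.Fin.Subset using (Subset; _∈_; _∩_; _─_; Empty; ∣_∣)
open import Data.Integer.Base using (+_)
open import Data.List.Base using (List; length)
import Data.List.Membership.Propositional as List
open import Data.List.Relation.Unary.Unique.Propositional using (Unique)
open import Data.Nat.Base as ℕ using (ℕ)
import Data.Nat.Properties as ℕ
open import Data.Product.Base using (_×_; ∃; ∃-syntax)
open import Data.Rational.Base using (ℚ; 0ℚ; _/_; _+_; _-_; NonZero; Positive; -_)
open import Data.Rational.Properties
  using (+-0-group; +-assoc; +-identityˡ; +-inverseʳ; neg-distrib-+; normalize-pos; pos⇒nonZero)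
open import Data.Vec.Base using (Vec; lookup; tabulate)
open import Relation.Binary.PropositionalEquality
  using (_≡_; _≢_; refl; sym; cong; subst; module ≡-Reasoning)
open import Relation.Nullary.Decidable using (does)

Word : ℕ → ℕ → Set
Word q n = Vec (Fin q) n

module _ {q n : ℕ} where

  supp : Word q n → Subset n
  supp x = tabulate λ i → not (does (toℕ (lookup x i) ℕ.≟ 0))

  wt : Word q n → ℕ
  wt x = ∣ supp x ∣

  d_H : Word q n → Word q n → ℕ
  d_H x y = ∣ tabulate (λ i → not (does (lookup x i Fin.≟ lookup y i))) ∣

-- A code is a (finite) set of words, listed without repetition.
record Code (q n : ℕ) : Set where
  field
    words  : List (Word q n)
    unique : Unique words

module _ {q n : ℕ} where

  size : Code q n → ℕ
  size C = length (Code.words C)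

  infix 4 _∈C_

  _∈C_ : Word q n → Code q n → Set
  x ∈C C = x List.∈ Code.words C

  ConstantWeight : ℕ → Code q n → Set
  ConstantWeight k C = ∀ {x} → x ∈C C → wt x ≡ k

  Equidistant : ℕ → Code q n → Set
  Equidistant d C = ∀ {x y} → x ∈C C → y ∈C C → x ≢ y → d_H x y ≡ d

ι : ℕ → ℚ
ι m = + m / 1

-- The parameter l may be a half-integer, hence is rational.
IsFamily : (q n k : ℕ) (l : ℚ) → Code q n → Set
IsFamily q n k l F =
  ConstantWeight k F × ∃[ d ] (l ≡ ι k - + d / 2 × Equidistant d F)

IsΔ-System : (q n k : ℕ) (l : ℚ) → Code q n → Set
IsΔ-System q n k l C =
  ConstantWeight k C ×
  ∃ λ (D : Subset n) →
    ( ι ∣ D ∣ ≡ l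
    × (∀ {x y} → x ∈C C → y ∈C C → x ≢ y → ∀ {i} → i ∈ D →
         lookup x i ≡ lookup y i × toℕ (lookup x i) ≢ 0)
    × (∀ {x y} → x ∈C C → y ∈C C → x ≢ y →
         Empty ((supp x ─ D) ∩ (supp y ─ D))))

k-l-nonZero : (k d : ℕ) (l : ℚ) → 0 ℕ.< d → l ≡ ι k - + d / 2 → NonZero (ι k - l)
k-l-nonZero k d _ 0<d refl =
  subst NonZero (sym eq) (pos⇒nonZero (+ d / 2) {{pos}})
  where
  pos : Positive (+ d / 2)
  pos = normalize-pos d 2 {{_}} {{ℕ.>-nonZero 0<d}}

  open GroupProperties +-0-group using () renaming (⁻¹-involutive to neg-involutive)
  open ≡-Reasoning

  eq : ι k - (ι k - + d / 2) ≡ + d / 2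
  eq = begin
    ι k - (ι k - + d / 2)          ≡⟨ cong (λ z → ι k + z) (neg-distrib-+ (ι k) (- (+ d / 2))) ⟩
    ι k + (- ι k + - - (+ d / 2))  ≡⟨ +-assoc (ι k) (- ι k) _ ⟨
    ι k - ι k + - - (+ d / 2)      ≡⟨ cong (_+ - - (+ d / 2)) (+-inverseʳ (ι k)) ⟩
    0ℚ + - - (+ d / 2)             ≡⟨ +-identityˡ _ ⟩
    - - (+ d / 2)                  ≡⟨ neg-involutive (+ d / 2) ⟩
    + d / 2                        ∎

-- A word x is encoded by a 0-1 vector of length n q whose inner products are
-- x · y = wt x + wt y - d_H x y, so that a family of m words gives 0-1 vectors with x · x = 2k and
-- x · y = 2k - d. It suffices to show (Deza) that every column is either full or has at most one entry 1.
-- For a column p with sum r_p, the integer vector with entries m (#rows with 1 in columns p and s) - r_p r_s has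
-- zero sum and norm d m r_p (m - r_p), which forces r_p ≤ d + 1 or m - r_p ≤ d + 1. Complementing the columns of the second
-- kind, i.e. adding mod 2 their indicator c, gives sparse 0-1 vectors x_i with x_i · x_j = g - t_i - t_j for
-- i ≠ j and x_i · x_i = g - 2 t_i + d. The numbers y_i = g - 2 t_i have pairwise nonnegative sums, and double
-- counting the squares of the column sums gives Σ y_i < m. Hence min y_i is 0 or -1. The value -1 yields a
-- projective plane of order d with a set meeting all but one of the vectors in the same number of points, which is
-- impossible by divisibility. The value 0 makes all y_i vanish, so the x_i are disjoint, and m > 2l + 2 makes them
-- disjoint from c, so that the complemented columns are full and the others have at most one entry 1.
-- A full support column is constant since m > q - 1; these columns form the kernel.

{-# OPTIONS --safe #-}
module Submission where

open import Defs
open import Data.Bool.Base using (true; if_then_else_)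
open import Data.Empty using (⊥; ⊥-elim)
open import Data.Fin.Base using (Fin; zero; suc; toℕ; punchIn; punchOut; fromℕ<; combine; remQuot; _↑ˡ_; _↑ʳ_)
import Data.Fin.Properties as Fin
open import Data.Fin.Subset using (Subset; _∈_; _∉_; _∩_; _─_; Empty; ∣_∣; inside; outside)
open import Data.Fin.Subset.Properties using (x∈p∩q⁻; p─q⊆p)
open import Data.List.Base as List using (List)
open import Data.List.Membership.Propositional.Properties using (∈-lookup)
open import Data.List.Relation.Unary.All as All using ()
open import Data.List.Relation.Unary.AllPairs using (_∷_)
open import Data.List.Relation.Unary.Any as Any using ()
open import Data.List.Relation.Unary.Any.Properties using (lookup-index)
open import Data.List.Relation.Unary.Unique.Propositional using (Unique)
open import Data.Nat.Base as ℕ using (ℕ)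
import Data.Nat.Properties as ℕ
open import Data.Product.Base using (_×_; _,_; proj₁; proj₂; ∃; ∃-syntax)
open import Data.Sum.Base using (_⊎_; inj₁; inj₂)
open import Data.Vec.Base using (lookup; tabulate; _∷_; here; there)
open import Data.Vec.Functional using (Vector)
open import Data.Vec.Properties using (lookup∘tabulate; []=⇒lookup; lookup⇒[]=)
open import Function.Base using (_∘_; case_of_)
open import Relation.Binary.PropositionalEquality
open import Relation.Nullary using (¬_; yes; no; contradiction; Dec; does)
open import Relation.Nullary.Decidable using (¬?; _×-dec_; decidable-stable)

module Vectors where

  -- Integer inequalities, finite sums and inner products

  open import Data.Integer.Base using (ℤ; +_; -[1+_]; 0ℤ; 1ℤ; _+_; _*_; _-_; -_; _≤_; +≤+; -≤-)
  open import Data.Integer.Properties as ℤ using (≤-refl; ≤-trans; ≤-reflexive; ≤-antisym)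
  open import Data.Integer.Tactic.RingSolver using (solve-∀)
  open import Algebra.Properties.Semiring.Sum ℤ.+-*-semiring
    using (sum; sum-remove; sum-cong-≗; ∑-distrib-+; ∑-comm; *-distribˡ-sum)

  private
    variable
      n n′ : ℕ

  -- Opaque so that the equality proofs, which come from the ring solver, are never evaluated.
  opaque

    -- Polynomial inequalities are proved by certificates: the difference to be bounded is written
    -- as a combination of nonnegative terms, assembled with `⊕` and `⊗`, and the ring solver checks
    -- the identity. A contradiction is certified in the same way by `absurd`, with a nonnegative
    -- combination that equals -1.
    from-diff : ∀ {x y} w → 0ℤ ≤ w → y - x ≡ w → x ≤ y
    from-diff w 0≤w eq = ℤ.0≤i-j⇒j≤i (subst (0ℤ ≤_) (sym eq) 0≤w)

    absurd : ∀ {w} → 0ℤ ≤ w → w ≡ - 1ℤ → ⊥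
    absurd 0≤w refl = case 0≤w of λ ()

  diff : ∀ {x y} → x ≤ y → 0ℤ ≤ y - x
  diff = ℤ.i≤j⇒0≤j-i

  infixl 6 _⊕_
  infixl 7 _⊗_

  _⊕_ : ∀ {x y} → 0ℤ ≤ x → 0ℤ ≤ y → 0ℤ ≤ x + y
  _⊕_ = ℤ.+-mono-≤

  _⊗_ : ∀ {x y} → 0ℤ ≤ x → 0ℤ ≤ y → 0ℤ ≤ x * y
  _⊗_ {+ a} {+ b} _ _ = subst (0ℤ ≤_) (ℤ.pos-* a b) (+≤+ ℕ.z≤n)

  0≤n : ∀ {n} → 0ℤ ≤ + n
  0≤n = +≤+ ℕ.z≤n

  ≰⇒1+≤ : ∀ {x y} → ¬ (x ≤ y) → y + 1ℤ ≤ x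
  ≰⇒1+≤ {x} {y} x≰y = subst (_≤ x) (ℤ.+-comm 1ℤ y) (ℤ.i<j⇒suc[i]≤j (ℤ.≰⇒> x≰y))

  square-nonneg : ∀ x → 0ℤ ≤ x * x
  square-nonneg (+ a)    = 0≤n {a} ⊗ 0≤n {a}
  square-nonneg -[1+ a ] = +≤+ ℕ.z≤n

  -- A product of two consecutive integers is never negative. This is where integrality of the
  -- vectors enters; over the rationals it fails between -1 and 0.
  square-+-nonneg : ∀ x → 0ℤ ≤ x * x + x
  square-+-nonneg (+ a)    = (0≤n {a} ⊗ 0≤n {a}) ⊕ 0≤n {a}
  square-+-nonneg -[1+ a ] = subst (0ℤ ≤_) (eq (+ a)) ((0≤n {a} ⊗ 0≤n {a}) ⊕ 0≤n {a})
    where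
    eq : ∀ x → x * x + x ≡ (- (1ℤ + x)) * (- (1ℤ + x)) + (- (1ℤ + x))
    eq = solve-∀

  opaque

    ∑ : Vector ℤ n → ℤ
    ∑ = sum

    ∑-cong : {f g : Vector ℤ n} → (∀ i → f i ≡ g i) → ∑ f ≡ ∑ g
    ∑-cong = sum-cong-≗

    ∑-swap : (f : Fin n′ → Fin n → ℤ) → (∑ λ i → ∑ λ j → f i j) ≡ ∑ λ j → ∑ λ i → f i j
    ∑-swap = ∑-comm

    ∑-+ : (f g : Vector ℤ n) → (∑ λ i → f i + g i) ≡ ∑ f + ∑ g
    ∑-+ = ∑-distrib-+

    ∑-*ˡ : ∀ c (f : Vector ℤ n) → (∑ λ i → c * f i) ≡ c * ∑ f
    ∑-*ˡ c f = sym (*-distribˡ-sum c f)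

    ∑-zero : (f : Vector ℤ 0) → ∑ f ≡ 0ℤ
    ∑-zero f = refl

    ∑-suc : (f : Vector ℤ (ℕ.suc n)) → ∑ f ≡ f zero + ∑ (f ∘ suc)
    ∑-suc f = refl

    ∑-remove : (i : Fin (ℕ.suc n)) (f : Vector ℤ (ℕ.suc n)) → ∑ f ≡ f i + ∑ (f ∘ punchIn i)
    ∑-remove i f = sum-remove {i = i} f

    ∑-mono-≤ : {f g : Vector ℤ n} → (∀ i → f i ≤ g i) → ∑ f ≤ ∑ g
    ∑-mono-≤ {ℕ.zero}  f≤g = ≤-refl
    ∑-mono-≤ {ℕ.suc n} f≤g = ℤ.+-mono-≤ (f≤g zero) (∑-mono-≤ (f≤g ∘ suc))

    ∑-const : ∀ n c → (∑ {n} λ _ → c) ≡ + n * c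
    ∑-const ℕ.zero    c = refl
    ∑-const (ℕ.suc n) c = trans (cong (λ z → c + z) (∑-const n c)) (eq c (+ n))
      where
      eq : ∀ c x → c + x * c ≡ (1ℤ + x) * c
      eq = solve-∀

  ∑-nonneg : {f : Vector ℤ n} → (∀ i → 0ℤ ≤ f i) → 0ℤ ≤ ∑ f
  ∑-nonneg {n} {f} 0≤f = subst (_≤ ∑ f) (trans (∑-const n 0ℤ) (ℤ.*-zeroʳ (+ n))) (∑-mono-≤ 0≤f)

  -- Each side receives the exceptional term of the other, so the terms at `i` balance and the
  -- comparison is that of the remaining terms. This handles the diagonal of a Gram matrix without
  -- splitting the index set.
  ∑-except-≤ : (i : Fin n) {f g : Vector ℤ n} → (∀ j → j ≢ i → f j ≤ g j) →
    ∑ f + g i ≤ ∑ g + f i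
  ∑-except-≤ {ℕ.suc n} i {f} {g} f≤g = begin
    ∑ f + g i                       ≡⟨ cong (_+ g i) (∑-remove i f) ⟩
    f i + ∑ (f ∘ punchIn i) + g i   ≡⟨ id₁ (f i) (∑ (f ∘ punchIn i)) (g i) ⟩
    f i + g i + ∑ (f ∘ punchIn i)
      ≤⟨ ℤ.+-monoʳ-≤ (f i + g i) (∑-mono-≤ λ j → f≤g (punchIn i j) (Fin.punchInᵢ≢i i j)) ⟩
    f i + g i + ∑ (g ∘ punchIn i)   ≡⟨ id₂ (f i) (g i) (∑ (g ∘ punchIn i)) ⟩
    g i + ∑ (g ∘ punchIn i) + f i   ≡⟨ cong (_+ f i) (∑-remove i g) ⟨
    ∑ g + f i                       ∎
    where
    open ℤ.≤-Reasoning
    id₁ : ∀ a b c → a + b + c ≡ a + c + b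
    id₁ = solve-∀
    id₂ : ∀ a b c → a + b + c ≡ b + c + a
    id₂ = solve-∀

  ∑-except : (i : Fin n) {f g : Vector ℤ n} → (∀ j → j ≢ i → f j ≡ g j) →
    ∑ f + g i ≡ ∑ g + f i
  ∑-except i f≡g = ≤-antisym
    (∑-except-≤ i λ j j≢i → ≤-reflexive (f≡g j j≢i))
    (∑-except-≤ i λ j j≢i → ≤-reflexive (sym (f≡g j j≢i)))

  term≤∑ : {f : Vector ℤ n} → (∀ i → 0ℤ ≤ f i) → ∀ i → f i ≤ ∑ f
  term≤∑ {ℕ.suc n} {f} 0≤f i =
    from-diff (∑ (f ∘ punchIn i)) (∑-nonneg (0≤f ∘ punchIn i))
      (trans (cong (_- f i) (∑-remove i f)) (eq (f i) (∑ (f ∘ punchIn i))))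
    where
    eq : ∀ x y → x + y - x ≡ y
    eq = solve-∀

  -- The term at `i` may be negative, as happens when the lemma is applied to the numbers `y k - 1ℤ`
  -- with `i₀` for `i`.
  two-terms≤∑ : {f : Vector ℤ n} {i j : Fin n} → (∀ k → k ≢ i → 0ℤ ≤ f k) → i ≢ j → f i + f j ≤ ∑ f
  two-terms≤∑ {ℕ.suc n} {f} {i} {j} 0≤f i≢j =
    subst₂ _≤_ (cong (λ k → f i + f k) (Fin.punchIn-punchOut i≢j)) (sym (∑-remove i f))
      (ℤ.+-monoʳ-≤ (f i) (term≤∑ (λ k → 0≤f (punchIn i k) (Fin.punchInᵢ≢i i k)) (punchOut i≢j)))

  ∑≤0⇒term≡0 : {f : Vector ℤ n} → (∀ i → 0ℤ ≤ f i) → ∑ f ≤ 0ℤ → ∀ i → f i ≡ 0ℤ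
  ∑≤0⇒term≡0 0≤f s≤0 i = ≤-antisym (≤-trans (term≤∑ 0≤f i) s≤0) (0≤f i)

  ∑-neg : (f : Vector ℤ n) → (∑ λ i → - f i) ≡ - ∑ f
  ∑-neg f = trans (trans (∑-cong (λ i → eq (f i))) (∑-*ˡ (- 1ℤ) f)) (sym (eq (∑ f)))
    where
    eq : ∀ x → - x ≡ - 1ℤ * x
    eq = solve-∀

  ∑-- : (f g : Vector ℤ n) → (∑ λ i → f i - g i) ≡ ∑ f - ∑ g
  ∑-- f g = trans (∑-+ f (λ i → - g i)) (cong (λ z → ∑ f + z) (∑-neg g))

  infix 7 _·_

  _·_ : Vector ℤ n → Vector ℤ n → ℤ
  f · g = ∑ λ i → f i * g i

  ·-comm : (f g : Vector ℤ n) → f · g ≡ g · f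
  ·-comm f g = ∑-cong λ i → ℤ.*-comm (f i) (g i)

  combination-· : (u : Vector ℤ n′) (a : Fin n′ → Vector ℤ n) (w : Vector ℤ n) →
    (λ p → ∑ λ i → u i * a i p) · w ≡ ∑ λ i → u i * (a i · w)
  combination-· u a w = begin
    (∑ λ p → (∑ λ i → u i * a i p) * w p)
      ≡⟨ ∑-cong (λ p → trans (ℤ.*-comm (∑ λ i → u i * a i p) (w p)) (sym (∑-*ˡ (w p) _))) ⟩
    (∑ λ p → ∑ λ i → w p * (u i * a i p))   ≡⟨ ∑-swap (λ p i → w p * (u i * a i p)) ⟩
    (∑ λ i → ∑ λ p → w p * (u i * a i p))
      ≡⟨ ∑-cong (λ i → trans (∑-cong λ p → eq (w p) (u i) (a i p)) (∑-*ˡ (u i) (λ p → a i p * w p))) ⟩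
    (∑ λ i → u i * (a i · w))               ∎
    where
    open ≡-Reasoning
    eq : ∀ w u a → w * (u * a) ≡ u * (a * w)
    eq = solve-∀

  ∑-combination : (u : Vector ℤ n′) (a : Fin n′ → Vector ℤ n) →
    (∑ λ p → ∑ λ i → u i * a i p) ≡ ∑ λ i → u i * ∑ (a i)
  ∑-combination u a =
    trans (∑-swap (λ p i → u i * a i p)) (∑-cong λ i → ∑-*ˡ (u i) (a i))

  -- Columns of a 0-1 matrix with a two-valued Gram matrix

  -- `E` bounds the rarer of the two entries in every column. For `δ ≡ 1ℤ` the sharper value 1 is
  -- recorded because it gives `Y ≤ 0ℤ` later, which `δ + 1ℤ` would not give when there are only
  -- four rows.
  ColumnBound : ℤ → ℤ → Set
  ColumnBound δ E = (δ ≡ 1ℤ × E ≡ 1ℤ) ⊎ (+ 2 ≤ δ × E ≡ δ + 1ℤ)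

  private
    -- Division of the inequality by `z` leaves `z + 1 ≤ D`.
    product-large : ∀ {z D} → 1ℤ ≤ z → z * z + z ≤ D * z → D ≤ z → ⊥
    product-large {z} {D} 1≤z z²+z≤Dz D≤z =
      absurd (diff z²+z≤Dz ⊕ diff D≤z ⊗ ≤-trans (+≤+ ℕ.z≤n) 1≤z ⊕ diff 1≤z) (eq z D)
      where
      eq : ∀ z D → (D * z - (z * z + z)) + (z - D) * z + (z - 1ℤ) ≡ - 1ℤ
      eq = solve-∀

    product≥1 : ∀ {r s} → 1ℤ ≤ r → 1ℤ ≤ s → 1ℤ ≤ r * s
    product≥1 {r} {s} 1≤r 1≤s =
      from-diff _ (diff 1≤r ⊗ diff 1≤s ⊕ diff 1≤r ⊕ diff 1≤s) (eq r s)
      where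
      eq : ∀ r s → r * s - 1ℤ ≡ (r - 1ℤ) * (s - 1ℤ) + (r - 1ℤ) + (s - 1ℤ)
      eq = solve-∀

    -- If both `r` and `s` exceed `E`, then `δ * (r + s) ≤ r * s`: the product of the excesses is
    -- nonnegative, and the size of `r + s` covers the remainder. This contradicts the last
    -- hypothesis after division by `r * s`.
    unbalanced : ∀ {δ E r s} → ColumnBound δ E → δ * δ + δ + + 2 ≤ r + s →
      (r * s) * (r * s) + r * s ≤ (δ * (r + s)) * (r * s) → r ≤ E ⊎ s ≤ E
    unbalanced {δ} {E} {r} {s} bound large ineq with r ℤ.≤? E | s ℤ.≤? E
    ... | yes r≤E | _       = inj₁ r≤E
    ... | no _    | yes s≤E = inj₂ s≤E
    ... | no r≰E  | no s≰E  = ⊥-elim (impossible bound (≰⇒1+≤ r≰E) (≰⇒1+≤ s≰E))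
      where
      impossible : ColumnBound δ E → E + 1ℤ ≤ r → E + 1ℤ ≤ s → ⊥
      impossible (inj₁ (refl , refl)) 2≤r 2≤s =
        product-large {r * s} (product≥1 (≤-trans (+≤+ (ℕ.s≤s ℕ.z≤n)) 2≤r) (≤-trans (+≤+ (ℕ.s≤s ℕ.z≤n)) 2≤s)) ineq
          (small 2≤r 2≤s)
        where
        eq : ∀ r s → r * s - 1ℤ * (r + s) ≡ (r - + 2) * (s - + 2) + (r - + 2) + (s - + 2)
        eq = solve-∀
        small : ∀ {r s} → + 2 ≤ r → + 2 ≤ s → 1ℤ * (r + s) ≤ r * s
        small {r} {s} 2≤r 2≤s = from-diff _ (diff 2≤r ⊗ diff 2≤s ⊕ diff 2≤r ⊕ diff 2≤s) (eq r s)
      impossible (inj₂ (2≤δ , refl)) δ+2≤r δ+2≤s =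
        product-large {r * s} (product≥1 (≤-trans 1≤δ+2 δ+2≤r) (≤-trans 1≤δ+2 δ+2≤s)) ineq
          (from-diff _
            (0≤n {2} ⊗ diff large ⊕ (≤-trans (+≤+ ℕ.z≤n) 2≤δ) ⊗ diff 2≤δ ⊕ diff δ+2≤r ⊗ diff δ+2≤s)
            (eq δ r s))
        where
        1≤δ+2 : 1ℤ ≤ δ + 1ℤ + 1ℤ
        1≤δ+2 = ℤ.+-mono-≤ (ℤ.+-mono-≤ (≤-trans (+≤+ ℕ.z≤n) 2≤δ) (+≤+ ℕ.z≤n)) ≤-refl
        eq : ∀ δ r s → r * s - δ * (r + s) ≡
          + 2 * (r + s - (δ * δ + δ + + 2)) + δ * (δ - + 2) + (r - (δ + 1ℤ + 1ℤ)) * (s - (δ + 1ℤ + 1ℤ))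
        eq = solve-∀

  module _ {m N : ℕ} (a : Fin m → Vector ℤ N) (ℓ δ : ℤ)
    (a·a : ∀ i → a i · a i ≡ ℓ + δ)
    (a·b : ∀ i j → j ≢ i → a i · a j ≡ ℓ)
    where

    -- The Gram matrix is `ℓ` times the all-ones matrix plus `δ` times the identity. In particular
    -- every `u` with zero sum is an eigenvector for `δ`.
    gram-combination : (u : Vector ℤ m) (i : Fin m) → (∑ λ j → u j * (a j · a i)) ≡ ℓ * ∑ u + δ * u i
    gram-combination u i = begin
      S                                       ≡⟨ id₁ S (ℓ * u i) ⟨
      S + ℓ * u i - ℓ * u i
        ≡⟨ cong (_- ℓ * u i) (∑-except i λ j j≢i → trans (cong (u j *_) (trans (·-comm (a j) (a i)) (a·b i j j≢i))) (ℤ.*-comm (u j) ℓ)) ⟩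
      (∑ λ j → ℓ * u j) + u i * (a i · a i) - ℓ * u i ≡⟨ cong₂ (λ x y → x + u i * y - ℓ * u i) (∑-*ˡ ℓ u) (a·a i) ⟩
      ℓ * ∑ u + u i * (ℓ + δ) - ℓ * u i       ≡⟨ id₂ (∑ u) (u i) ℓ δ ⟩
      ℓ * ∑ u + δ * u i                       ∎
      where
      open ≡-Reasoning
      S = ∑ λ j → u j * (a j · a i)
      id₁ : ∀ x y → x + y - y ≡ x
      id₁ = solve-∀
      id₂ : ∀ U u ℓ δ → ℓ * U + u * (ℓ + δ) - ℓ * u ≡ ℓ * U + δ * u
      id₂ = solve-∀

    module _ (idem : ∀ i p → a i p * a i p ≡ a i p) (p : Fin N) where
      private
        M r s : ℤ
        M = + m
        r = ∑ λ i → a i p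
        s = M - r
        -- Column `p` centred at its mean and scaled by `M`, which keeps it integral. The
        -- combination `v` of the rows with these coefficients is the test vector.
        u : Vector ℤ m
        u i = M * a i p - r
        v : Vector ℤ N
        v q = ∑ λ i → u i * a i q

        ∑u : ∑ u ≡ 0ℤ
        ∑u = begin
          ∑ u                                       ≡⟨ ∑-- (λ i → M * a i p) (λ _ → r) ⟩
          (∑ λ i → M * a i p) - (∑ {m} λ _ → r)     ≡⟨ cong₂ _-_ (∑-*ˡ M (λ i → a i p)) (∑-const m r) ⟩
          M * r - M * r                             ≡⟨ ℤ.+-inverseʳ (M * r) ⟩
          0ℤ                                        ∎
          where open ≡-Reasoning

        vp : v p ≡ r * s
        vp = begin
          (∑ λ i → u i * a i p)
            ≡⟨ ∑-cong (λ i → trans (id₁ M r (a i p)) (cong (λ z → M * z - r * a i p) (idem i p))) ⟩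
          (∑ λ i → M * a i p - r * a i p) ≡⟨ ∑-- (λ i → M * a i p) (λ i → r * a i p) ⟩
          (∑ λ i → M * a i p) - (∑ λ i → r * a i p) ≡⟨ cong₂ _-_ (∑-*ˡ M (λ i → a i p)) (∑-*ˡ r (λ i → a i p)) ⟩
          M * r - r * r                   ≡⟨ id₂ M r ⟩
          r * s                           ∎
          where
          open ≡-Reasoning
          id₁ : ∀ M r x → (M * x - r) * x ≡ M * (x * x) - r * x
          id₁ = solve-∀
          id₂ : ∀ M r → M * r - r * r ≡ r * (M - r)
          id₂ = solve-∀

        u·u : u · u ≡ M * (r * s)
        u·u = begin
          u · u                                       ≡⟨ ∑-cong (λ i → id₁ M r (a i p) (u i)) ⟩
          (∑ λ i → M * (u i * a i p) - r * u i)       ≡⟨ ∑-- (λ i → M * (u i * a i p)) (λ i → r * u i) ⟩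
          (∑ λ i → M * (u i * a i p)) - (∑ λ i → r * u i) ≡⟨ cong₂ _-_ (∑-*ˡ M (λ i → u i * a i p)) (∑-*ˡ r u) ⟩
          M * v p - r * ∑ u                           ≡⟨ cong₂ (λ x y → M * x - r * y) vp ∑u ⟩
          M * (r * s) - r * 0ℤ                        ≡⟨ id₂ (M * (r * s)) r ⟩
          M * (r * s)                                 ∎
          where
          open ≡-Reasoning
          id₁ : ∀ M r x u → u * (M * x - r) ≡ M * (u * x) - r * u
          id₁ = solve-∀
          id₂ : ∀ x r → x - r * 0ℤ ≡ x
          id₂ = solve-∀

        a·v : ∀ i → a i · v ≡ δ * u i
        a·v i = begin
          a i · v                           ≡⟨ ·-comm (a i) v ⟩
          v · a i                           ≡⟨ combination-· u a (a i) ⟩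
          (∑ λ j → u j * (a j · a i))       ≡⟨ gram-combination u i ⟩
          ℓ * ∑ u + δ * u i                 ≡⟨ cong (λ z → ℓ * z + δ * u i) ∑u ⟩
          ℓ * 0ℤ + δ * u i                  ≡⟨ id₁ ℓ (δ * u i) ⟩
          δ * u i                           ∎
          where
          open ≡-Reasoning
          id₁ : ∀ x y → x * 0ℤ + y ≡ y
          id₁ = solve-∀

        v·v : v · v ≡ δ * M * (r * s)
        v·v = begin
          v · v                       ≡⟨ combination-· u a v ⟩
          (∑ λ i → u i * (a i · v))   ≡⟨ ∑-cong (λ i → trans (cong (u i *_) (a·v i)) (id₁ (u i) δ)) ⟩
          (∑ λ i → δ * (u i * u i))   ≡⟨ ∑-*ˡ δ (λ i → u i * u i) ⟩
          δ * (u · u)                 ≡⟨ cong (δ *_) u·u ⟩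
          δ * (M * (r * s))           ≡⟨ ℤ.*-assoc δ M (r * s) ⟨
          δ * M * (r * s)             ∎
          where
          open ≡-Reasoning
          id₁ : ∀ u δ → u * (δ * u) ≡ δ * (u * u)
          id₁ = solve-∀

        ∑a : ∀ i → ∑ (a i) ≡ ℓ + δ
        ∑a i = trans (∑-cong λ q → sym (idem i q)) (a·a i)

        ∑v : ∑ v ≡ 0ℤ
        ∑v = begin
          ∑ v                              ≡⟨ ∑-combination u a ⟩
          (∑ λ i → u i * ∑ (a i))
            ≡⟨ ∑-cong (λ i → trans (cong (u i *_) (∑a i)) (ℤ.*-comm (u i) (ℓ + δ))) ⟩
          (∑ λ i → (ℓ + δ) * u i)          ≡⟨ ∑-*ˡ (ℓ + δ) u ⟩
          (ℓ + δ) * ∑ u                    ≡⟨ cong ((ℓ + δ) *_) ∑u ⟩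
          (ℓ + δ) * 0ℤ                     ≡⟨ ℤ.*-zeroʳ (ℓ + δ) ⟩
          0ℤ                               ∎
          where open ≡-Reasoning

      -- The integer vector v has zero sum and v² + v ≥ 0 entrywise, so its entry at p is bounded by its norm.
      column-inequality : (r * s) * (r * s) + r * s ≤ δ * M * (r * s)
      column-inequality = begin
        (r * s) * (r * s) + r * s     ≡⟨ cong (λ z → z * z + z) vp ⟨
        v p * v p + v p               ≤⟨ term≤∑ (λ q → square-+-nonneg (v q)) p ⟩
        (∑ λ q → v q * v q + v q)     ≡⟨ ∑-+ (λ q → v q * v q) v ⟩
        v · v + ∑ v                   ≡⟨ cong₂ _+_ v·v ∑v ⟩
        δ * M * (r * s) + 0ℤ          ≡⟨ ℤ.+-identityʳ (δ * M * (r * s)) ⟩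
        δ * M * (r * s)               ∎
        where open ℤ.≤-Reasoning

      few-or-almost-all : ∀ {E} → ColumnBound δ E → δ * δ + δ + + 2 ≤ M → r ≤ E ⊎ s ≤ E
      few-or-almost-all bound large = unbalanced bound (subst (_ ≤_) r+s large)
        (subst (λ z → (r * s) * (r * s) + r * s ≤ δ * z * (r * s)) r+s column-inequality)
        where
        eq : ∀ M r → M ≡ r + (M - r)
        eq = solve-∀
        r+s : M ≡ r + s
        r+s = eq M r

  ≡-of-diff : ∀ {x y} → x - y ≡ 0ℤ → x ≡ y
  ≡-of-diff {x} {y} = ℤ.i-j≡0⇒i≡j x y

  -- Sparse families

  another : ∀ {m} (i : Fin m) → + 2 ≤ + m → ∃ λ j → j ≢ i
  another {ℕ.suc ℕ.zero}    i       (+≤+ (ℕ.s≤s ()))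
  another {ℕ.suc (ℕ.suc _)} zero    _ = suc zero , λ ()
  another {ℕ.suc (ℕ.suc _)} (suc i) _ = zero , λ ()

  private
    -- The two bounds on `Y` force `M < 2 δ + 4`, whereas `δ² + δ + 2 ≥ 2 δ + 4` as soon as `δ ≥ 2`.
    norm-contradiction : ∀ {δ M Y} → Y + 1ℤ ≤ M → + 2 * (M - (δ + + 2)) ≤ Y → δ * δ + δ + + 2 ≤ M → + 2 ≤ δ → ⊥
    norm-contradiction {δ} {M} {Y} Y<M Y≥ large 2≤δ = absurd
      (diff Y<M ⊕ diff Y≥ ⊕ diff large ⊕ ≤-trans (+≤+ ℕ.z≤n) 2≤δ ⊗ diff 2≤δ ⊕ diff 2≤δ) (eq δ M Y)
      where
      eq : ∀ δ M Y → (M - (Y + 1ℤ)) + (Y - + 2 * (M - (δ + + 2))) + (M - (δ * δ + δ + + 2))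
        + δ * (δ - + 2) + (δ - + 2) ≡ - 1ℤ
      eq = solve-∀

  -- The situation after complementing, described by inner products and column sums alone: `c` is
  -- the set of complemented columns and the `x i` are the rows of the sparse matrix. The aim is
  -- that the `x i` are disjoint from each other and from `c`.
  module _ {m N : ℕ} (x : Fin m → Vector ℤ N) (c : Vector ℤ N) (t : Vector ℤ m) (g ℓ δ E : ℤ)
    (idem : ∀ i p → x i p * x i p ≡ x i p) (c-idem : ∀ p → c p * c p ≡ c p)
    (x·x : ∀ i → x i · x i ≡ g - + 2 * t i + δ)
    (x·x′ : ∀ i j → j ≢ i → x i · x j ≡ g - t i - t j)
    (c·x : ∀ i → c · x i ≡ g - t i) (∑c : ∑ c ≡ ℓ + g) (t≤δ : ∀ i → t i ≤ δ)
    (0≤ℓ : 0ℤ ≤ ℓ) (bound : ColumnBound δ E) (e≤E : ∀ p → (∑ λ i → x i p) ≤ E)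
    (large : δ * δ + δ + + 2 ≤ + m) (ℓ+3≤m : ℓ + + 3 ≤ + m)
    where

    private
      M T Y : ℤ
      M = + m
      T = ∑ t
      Y = g * M - + 2 * T

      -- `y i` is the excess of `x i · x i` over `δ`, and for `i ≢ j` the product `x i · x j` is the
      -- mean of `y i` and `y j`. The sum of all `y i` is `Y`.
      y : Vector ℤ m
      y i = g - + 2 * t i

      e : Vector ℤ N
      e p = ∑ λ i → x i p

      _∙x : Vector ℤ m → Vector ℤ N
      (w ∙x) p = ∑ λ i → w i * x i p

      ones : Vector ℤ m
      ones _ = 1ℤ

      1≤δ : 1ℤ ≤ δ
      1≤δ = case bound of λ where
        (inj₁ (refl , _)) → ≤-refl
        (inj₂ (2≤δ , _))  → ≤-trans (+≤+ (ℕ.s≤s ℕ.z≤n)) 2≤δ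

      0≤δ : 0ℤ ≤ δ
      0≤δ = ≤-trans (+≤+ ℕ.z≤n) 1≤δ

      E≤δ+1 : E ≤ δ + 1ℤ
      E≤δ+1 = case bound of λ where
        (inj₁ (refl , refl)) → +≤+ (ℕ.s≤s ℕ.z≤n)
        (inj₂ (_ , refl))    → ≤-refl

      4≤M : + 4 ≤ M
      4≤M = from-diff _ (diff large ⊕ diff 1≤δ ⊗ 0≤δ ⊕ 0≤n {2} ⊗ diff 1≤δ) (eq δ M)
        where
        eq : ∀ δ M → M - + 4 ≡ (M - (δ * δ + δ + + 2)) + (δ - 1ℤ) * δ + + 2 * (δ - 1ℤ)
        eq = solve-∀

      0≤x : ∀ i p → 0ℤ ≤ x i p
      0≤x i p = subst (0ℤ ≤_) (idem i p) (square-nonneg (x i p))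

      0≤c : ∀ p → 0ℤ ≤ c p
      0≤c p = subst (0ℤ ≤_) (c-idem p) (square-nonneg (c p))

      0≤e : ∀ p → 0ℤ ≤ e p
      0≤e p = ∑-nonneg λ i → 0≤x i p

      0≤x·x′ : ∀ i j → 0ℤ ≤ x i · x j
      0≤x·x′ i j = ∑-nonneg λ p → 0≤x i p ⊗ 0≤x j p

      ∑x : ∀ i → ∑ (x i) ≡ g - + 2 * t i + δ
      ∑x i = trans (∑-cong λ p → sym (idem i p)) (x·x i)

      -- The Gram matrix of the `x i` is `δ` times the identity plus the matrix with entries
      -- `g - t i - t j`, so apart from `w i` the coefficients enter only through `∑ w` and `w · t`.
      ∙x-· : ∀ w i → (w ∙x) · x i ≡ ∑ w * (g - t i) - w · t + δ * w i
      ∙x-· w i = begin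
        (w ∙x) · x i
          ≡⟨ combination-· w x (x i) ⟩
        S
          ≡⟨ id₁ S (w i * (g - t i - t i)) ⟩
        S + w i * (g - t i - t i) - w i * (g - t i - t i)
          ≡⟨ cong (_- w i * (g - t i - t i)) (∑-except i λ j j≢i → cong (w j *_) (trans (·-comm (x j) (x i)) (x·x′ i j j≢i))) ⟩
        R + w i * (x i · x i) - w i * (g - t i - t i)
          ≡⟨ cong₂ (λ u v → u + w i * v - w i * (g - t i - t i)) ∑R (x·x i) ⟩
        ((g - t i) * ∑ w - w · t) + w i * (g - + 2 * t i + δ) - w i * (g - t i - t i)
          ≡⟨ id₂ (∑ w) (w · t) (w i) g (t i) δ ⟩
        ∑ w * (g - t i) - w · t + δ * w i
          ∎
        where
        open ≡-Reasoning
        S = ∑ λ j → w j * (x j · x i)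
        R = ∑ λ j → w j * (g - t i - t j)
        id₀ : ∀ w g s t → w * (g - s - t) ≡ (g - s) * w - w * t
        id₀ = solve-∀
        id₁ : ∀ S z → S ≡ S + z - z
        id₁ = solve-∀
        id₂ : ∀ W V w g t δ → ((g - t) * W - V) + w * (g - + 2 * t + δ) - w * (g - t - t) ≡ W * (g - t) - V + δ * w
        id₂ = solve-∀
        ∑R : R ≡ (g - t i) * ∑ w - w · t
        ∑R = trans (∑-cong λ j → id₀ (w j) g (t i) (t j))
          (trans (∑-- (λ j → (g - t i) * w j) (λ j → w j * t j)) (cong (_- w · t) (∑-*ˡ (g - t i) w)))

      norm-∙x : ∀ w → (w ∙x) · (w ∙x) ≡ ∑ w * (g * ∑ w - + 2 * (w · t)) + δ * (w · w)
      norm-∙x w = begin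
        (w ∙x) · (w ∙x)
          ≡⟨ combination-· w x (w ∙x) ⟩
        (∑ λ i → w i * (x i · (w ∙x)))
          ≡⟨ ∑-cong (λ i → trans (cong (w i *_) (trans (·-comm (x i) (w ∙x)) (∙x-· w i))) (id₁ (∑ w) (w · t) (w i) g (t i) δ)) ⟩
        (∑ λ i → (∑ w * g - w · t) * w i - ∑ w * (w i * t i) + δ * (w i * w i))
          ≡⟨ ∑-+ (λ i → (∑ w * g - w · t) * w i - ∑ w * (w i * t i)) (λ i → δ * (w i * w i)) ⟩
        (∑ λ i → (∑ w * g - w · t) * w i - ∑ w * (w i * t i)) + (∑ λ i → δ * (w i * w i))
          ≡⟨ cong₂ _+_
               (trans (∑-- (λ i → (∑ w * g - w · t) * w i) (λ i → ∑ w * (w i * t i)))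
                 (cong₂ _-_ (∑-*ˡ (∑ w * g - w · t) w) (∑-*ˡ (∑ w) (λ i → w i * t i))))
               (∑-*ˡ δ (λ i → w i * w i)) ⟩
        (∑ w * g - w · t) * ∑ w - ∑ w * (w · t) + δ * (w · w)
          ≡⟨ id₂ (∑ w) (w · t) g (δ * (w · w)) ⟩
        ∑ w * (g * ∑ w - + 2 * (w · t)) + δ * (w · w)
          ∎
        where
        open ≡-Reasoning
        id₁ : ∀ W V w g t δ → w * (W * (g - t) - V + δ * w) ≡ (W * g - V) * w - W * (w * t) + δ * (w * w)
        id₁ = solve-∀
        id₂ : ∀ W V g z → (W * g - V) * W - W * V + z ≡ W * (g * W - + 2 * V) + z
        id₂ = solve-∀

      ∑-∙x : ∀ w → ∑ (w ∙x) ≡ (g * ∑ w - + 2 * (w · t)) + δ * ∑ w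
      ∑-∙x w = begin
        ∑ (w ∙x)
          ≡⟨ ∑-combination w x ⟩
        (∑ λ i → w i * ∑ (x i))
          ≡⟨ ∑-cong (λ i → trans (cong (w i *_) (∑x i)) (id₁ (w i) g (t i) δ)) ⟩
        (∑ λ i → (g + δ) * w i - + 2 * (w i * t i))
          ≡⟨ ∑-- (λ i → (g + δ) * w i) (λ i → + 2 * (w i * t i)) ⟩
        (∑ λ i → (g + δ) * w i) - (∑ λ i → + 2 * (w i * t i))
          ≡⟨ cong₂ _-_ (∑-*ˡ (g + δ) w) (∑-*ˡ (+ 2) (λ i → w i * t i)) ⟩
        (g + δ) * ∑ w - + 2 * (w · t)
          ≡⟨ id₂ (∑ w) (w · t) g δ ⟩
        (g * ∑ w - + 2 * (w · t)) + δ * ∑ w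
          ∎
        where
        open ≡-Reasoning
        id₁ : ∀ w g t δ → w * (g - + 2 * t + δ) ≡ (g + δ) * w - + 2 * (w * t)
        id₁ = solve-∀
        id₂ : ∀ W V g δ → (g + δ) * W - + 2 * V ≡ (g * W - + 2 * V) + δ * W
        id₂ = solve-∀

      ones∙x : ∀ p → (ones ∙x) p ≡ e p
      ones∙x p = ∑-cong λ i → ℤ.*-identityˡ (x i p)

      ∑ones : ∑ ones ≡ M
      ∑ones = trans (∑-const m 1ℤ) (ℤ.*-identityʳ M)

      ones·t : ones · t ≡ T
      ones·t = ∑-cong λ i → ℤ.*-identityˡ (t i)

      ones·ones : ones · ones ≡ M
      ones·ones = ∑ones

      e·x : ∀ i → e · x i ≡ M * (g - t i) - T + δ
      e·x i = begin
        e · x i                                        ≡⟨ ∑-cong (λ p → cong (_* x i p) (sym (ones∙x p))) ⟩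
        (ones ∙x) · x i                                ≡⟨ ∙x-· ones i ⟩
        ∑ ones * (g - t i) - ones · t + δ * 1ℤ
          ≡⟨ cong₂ _+_ (cong₂ (λ u v → u * (g - t i) - v) ∑ones ones·t) (ℤ.*-identityʳ δ) ⟩
        M * (g - t i) - T + δ                          ∎
        where open ≡-Reasoning

      e·e : e · e ≡ M * Y + δ * M
      e·e = begin
        e · e
          ≡⟨ ∑-cong (λ p → cong₂ _*_ (sym (ones∙x p)) (sym (ones∙x p))) ⟩
        (ones ∙x) · (ones ∙x)                          ≡⟨ norm-∙x ones ⟩
        ∑ ones * (g * ∑ ones - + 2 * (ones · t)) + δ * (ones · ones)
          ≡⟨ cong₂ _+_ (cong₂ (λ u v → u * (g * u - + 2 * v)) ∑ones ones·t) (cong (δ *_) ones·ones) ⟩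
        M * Y + δ * M                                  ∎
        where open ≡-Reasoning

      ∑e : ∑ e ≡ Y + δ * M
      ∑e = begin
        ∑ e                                            ≡⟨ ∑-cong (λ p → sym (ones∙x p)) ⟩
        ∑ (ones ∙x)                                    ≡⟨ ∑-∙x ones ⟩
        (g * ∑ ones - + 2 * (ones · t)) + δ * ∑ ones   ≡⟨ cong₂ (λ u v → (g * u - + 2 * v) + δ * u) ∑ones ones·t ⟩
        Y + δ * M                                      ∎
        where open ≡-Reasoning

      ∑y : ∑ y ≡ Y
      ∑y = trans (∑-- (λ _ → g) (λ i → + 2 * t i)) (cong₂ _-_ (trans (∑-const m g) (ℤ.*-comm M g)) (∑-*ˡ (+ 2) t))

      e·e≤E∑e : M * Y + δ * M ≤ E * (Y + δ * M)
      e·e≤E∑e = begin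
        M * Y + δ * M        ≡⟨ e·e ⟨
        e · e                ≤⟨ ∑-mono-≤ (λ p → from-diff _ (0≤e p ⊗ diff (e≤E p)) (id₁ E (e p))) ⟩
        (∑ λ p → E * e p)    ≡⟨ ∑-*ˡ E e ⟩
        E * ∑ e              ≡⟨ cong (E *_) ∑e ⟩
        E * (Y + δ * M)      ∎
        where
        open ℤ.≤-Reasoning
        id₁ : ∀ E e → E * e - e * e ≡ e * (E - e)
        id₁ = solve-∀

      -- The last hypothesis says `(M - E) Y ≤ δ (E - 1) M`. The right side vanishes for `E ≡ 1ℤ`;
      -- for `E ≡ δ + 1ℤ` it is `δ² M`, while `M - E` exceeds `δ²`.
      Y-bound : ∀ {M Y δ E} → ColumnBound δ E → δ * δ + δ + + 2 ≤ M → 1ℤ ≤ M →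
        M * Y + δ * M ≤ E * (Y + δ * M) → (δ ≡ 1ℤ × Y ≤ 0ℤ) ⊎ (+ 2 ≤ δ × Y + 1ℤ ≤ M)
      Y-bound {M} {Y} (inj₁ (refl , refl)) large _ ineq =
        inj₁ (refl , ℤ.≮⇒≥ λ 0<Y → absurd
          (diff ineq ⊕ (diff large ⊕ 0≤n {3}) ⊗ diff (ℤ.i<j⇒suc[i]≤j 0<Y) ⊕ diff large ⊕ 0≤n {2}) (eq M Y))
        where
        eq : ∀ M Y → (1ℤ * (Y + 1ℤ * M) - (M * Y + 1ℤ * M)) + (M - + 4 + + 3) * (Y - 1ℤ) + (M - + 4) + + 2 ≡ - 1ℤ
        eq = solve-∀
      Y-bound {M} {Y} {δ} (inj₂ (2≤δ , refl)) large 1≤M ineq = inj₂ (2≤δ , Y+1≤M)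
        where
        eq : ∀ M Y δ → ((δ + 1ℤ) * (Y + δ * M) - (M * Y + δ * M)) + ((M - (δ * δ + δ + + 2)) + δ * δ + 1ℤ) * (Y - M)
          + M * (M - (δ * δ + δ + + 2)) + (M - 1ℤ) ≡ - 1ℤ
        eq = solve-∀
        Y+1≤M : Y + 1ℤ ≤ M
        Y+1≤M = ≰⇒1+≤ {M} {Y} (λ M≤Y → absurd
          (diff ineq ⊕ (diff large ⊕ square-nonneg δ ⊕ 0≤n {1}) ⊗ diff M≤Y
            ⊕ ≤-trans (+≤+ ℕ.z≤n) 1≤M ⊗ diff large ⊕ diff 1≤M) (eq M Y δ))

      Y-cases : (δ ≡ 1ℤ × Y ≤ 0ℤ) ⊎ (+ 2 ≤ δ × Y + 1ℤ ≤ M)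
      Y-cases = Y-bound bound large (≤-trans (+≤+ (ℕ.s≤s ℕ.z≤n)) 4≤M) e·e≤E∑e

      Y+1≤M : Y + 1ℤ ≤ M
      Y+1≤M = case Y-cases of λ where
        (inj₁ (_ , Y≤0)) → ≤-trans (ℤ.+-monoˡ-≤ 1ℤ Y≤0) (≤-trans (+≤+ (ℕ.s≤s ℕ.z≤n)) 4≤M)
        (inj₂ (_ , Y<M)) → Y<M

      pair-nonneg : ∀ i j → j ≢ i → 0ℤ ≤ y i + y j
      pair-nonneg i j j≢i = subst (0ℤ ≤_)
        (trans (cong (+ 2 *_) (x·x′ i j j≢i)) (id₁ g (t i) (t j))) (0≤n {2} ⊗ 0≤x·x′ i j)
        where
        id₁ : ∀ g s t → + 2 * (g - s - t) ≡ (g - + 2 * s) + (g - + 2 * t)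
        id₁ = solve-∀

      -- If all `y i` were positive, their sum `Y` would be at least `M`.
      small : ∃ λ i → y i ≤ 0ℤ
      small with Fin.any? (λ i → y i ℤ.≤? 0ℤ)
      ... | yes p = p
      ... | no ¬p = ⊥-elim (absurd (diff Y+1≤M ⊕ diff M≤Y) (id₁ M Y))
        where
        open ℤ.≤-Reasoning
        id₁ : ∀ M Y → (M - (Y + 1ℤ)) + (Y - M) ≡ - 1ℤ
        id₁ = solve-∀
        M≤Y : M ≤ Y
        M≤Y = begin
          M         ≡⟨ ∑ones ⟨
          ∑ ones    ≤⟨ ∑-mono-≤ (λ i → ≰⇒1+≤ {y i} {0ℤ} λ le → ¬p (i , le)) ⟩
          ∑ y       ≡⟨ ∑y ⟩
          Y         ∎

      -- Every other `y j` is at least `- y i`, so `Y` is at least `y i + (M - 1) (- y i)`.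
      least : ∀ i → (M - + 2) * - y i ≤ Y
      least i = from-diff _ (diff (subst₂ _≤_ (cong (_+ y i) (∑-const m (- y i))) (cong (_+ - y i) ∑y)
          (∑-except-≤ i {λ _ → - y i} {y} λ j j≢i → from-diff _ (pair-nonneg i j j≢i) (id₁ (y i) (y j)))))
        (id₂ M Y (y i))
        where
        id₁ : ∀ a b → b - - a ≡ a + b
        id₁ = solve-∀
        id₂ : ∀ M Y y → Y - (M - + 2) * - y ≡ (Y + - y) - (M * - y + y)
        id₂ = solve-∀

      -- A value of at most -2 would give `Y ≥ 2 (M - 2) ≥ M` by `least`.
      -1≤y : ∀ i → - 1ℤ ≤ y i
      -1≤y i = ℤ.≮⇒≥ λ y<-1 → absurd
        (diff (least i) ⊕ diff Y+1≤M ⊕ (diff 4≤M ⊕ 0≤n {2}) ⊗ diff (ℤ.i<j⇒suc[i]≤j y<-1) ⊕ diff 4≤M) (id₁ M Y (y i))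
        where
        id₁ : ∀ M Y y → (Y - (M - + 2) * - y) + (M - (Y + 1ℤ)) + (M - + 4 + + 2) * (- 1ℤ - (1ℤ + y)) + (M - + 4) ≡ - 1ℤ
        id₁ = solve-∀

      near-0 : ∀ {z} → z ≤ 0ℤ → - 1ℤ ≤ z → z ≡ 0ℤ ⊎ z ≡ - 1ℤ
      near-0 {+ 0} _ _ = inj₁ refl
      near-0 {+ ℕ.suc _} (+≤+ ()) _
      near-0 { -[1+ 0 ]} _ _ = inj₂ refl
      near-0 { -[1+ ℕ.suc _ ]} _ (-≤- ())

      c·e : c · e ≡ g * M - T
      c·e = begin
        c · e                          ≡⟨ ·-comm c e ⟩
        e · c                          ≡⟨ ∑-cong (λ p → cong (_* c p) (sym (ones∙x p))) ⟩
        (ones ∙x) · c                  ≡⟨ combination-· ones x c ⟩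
        (∑ λ i → 1ℤ * (x i · c))
          ≡⟨ ∑-cong (λ i → trans (ℤ.*-identityˡ (x i · c)) (trans (·-comm (x i) c) (c·x i))) ⟩
        (∑ λ i → g - t i)              ≡⟨ ∑-- (λ _ → g) t ⟩
        (∑ {m} λ _ → g) - T            ≡⟨ cong (_- T) (trans (∑-const m g) (ℤ.*-comm M g)) ⟩
        g * M - T                      ∎
        where open ≡-Reasoning

      -- Here the x j with j ≢ i₀ are the lines of a projective plane of order δ, and c meets each of them in τ
      -- points. As every point on a line lies on δ + 1 lines, δ + 1 divides (δ² + δ + 1) τ, hence τ; but 1 ≤ τ ≤ δ.
      module Plane (i₀ : Fin m) (y₀ : y i₀ ≡ - 1ℤ) where

        τ : ℤ
        τ = t i₀

        g≡ : g ≡ + 2 * τ - 1ℤ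
        g≡ = trans (id₁ g τ) (cong (λ z → + 2 * τ + z) y₀)
          where
          id₁ : ∀ g τ → g ≡ + 2 * τ + (g - + 2 * τ)
          id₁ = solve-∀

        -- All `y k` with `k ≢ i₀` are at least 1. The numbers `y k - 1ℤ` have negative sum and the
        -- one at `i₀` is -2, so each of the others is at most 1. As `y j` is odd, it must be 1.
        t≡ : ∀ j → j ≢ i₀ → t j ≡ τ - 1ℤ
        t≡ j j≢i₀ = trans (id₁ τ (t j)) (cong (λ z → τ - z) d≡1)
          where
          d : ℤ
          d = τ - t j
          id₁ : ∀ τ t → t ≡ τ - (τ - t)
          id₁ = solve-∀
          y≡ : y j ≡ + 2 * d - 1ℤ
          y≡ = trans (cong (_- + 2 * t j) g≡) (id₂ τ (t j))
            where
            id₂ : ∀ τ t → (+ 2 * τ - 1ℤ) - + 2 * t ≡ + 2 * (τ - t) - 1ℤ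
            id₂ = solve-∀
          y-large : ∀ k → k ≢ i₀ → 0ℤ ≤ y k - 1ℤ
          y-large k k≢i₀ = subst (0ℤ ≤_) (trans (cong (_+ y k) y₀) (ℤ.+-comm (- 1ℤ) (y k))) (pair-nonneg i₀ k k≢i₀)
          ∑y-1 : (∑ λ k → y k - 1ℤ) ≡ Y - M
          ∑y-1 = trans (∑-- y (λ _ → 1ℤ)) (cong₂ _-_ ∑y ∑ones)
          y-small : (- 1ℤ - 1ℤ) + (y j - 1ℤ) ≤ Y - M
          y-small = subst₂ _≤_ (cong (λ z → (z - 1ℤ) + (y j - 1ℤ)) y₀) ∑y-1
            (two-terms≤∑ {f = λ k → y k - 1ℤ} y-large (j≢i₀ ∘ sym))
          d≡1 : d ≡ 1ℤ
          d≡1 = ≤-antisym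
            (ℤ.≮⇒≥ λ 1<d → absurd (diff y-small ⊕ diff Y+1≤M ⊕ 0≤n {2} ⊗ diff (ℤ.i<j⇒suc[i]≤j 1<d))
              (trans (cong (λ z → (Y - M - (- 1ℤ - 1ℤ + (z - 1ℤ))) + (M - (Y + 1ℤ)) + + 2 * (d - (1ℤ + 1ℤ))) y≡) (id₃ Y M d)))
            (ℤ.≮⇒≥ λ d<1 → absurd (y-large j j≢i₀ ⊕ 0≤n {2} ⊗ diff (ℤ.i<j⇒suc[i]≤j d<1) ⊕ 0≤n {1})
              (trans (cong (λ z → (z - 1ℤ) + + 2 * (1ℤ - (1ℤ + d)) + 1ℤ) y≡) (id₄ d)))
            where
            id₃ : ∀ Y M d → (Y - M - (- 1ℤ - 1ℤ + (+ 2 * d - 1ℤ - 1ℤ))) + (M - (Y + 1ℤ)) + + 2 * (d - (1ℤ + 1ℤ)) ≡ - 1ℤ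
            id₃ = solve-∀
            id₄ : ∀ d → (+ 2 * d - 1ℤ - 1ℤ) + + 2 * (1ℤ - (1ℤ + d)) + 1ℤ ≡ - 1ℤ
            id₄ = solve-∀

        T≡ : T ≡ M * τ - M + 1ℤ
        T≡ = trans (id₁ T (τ - 1ℤ)) (trans (cong (_- (τ - 1ℤ)) (∑-except i₀ {t} {λ _ → τ - 1ℤ} t≡))
          (trans (cong (λ z → z + τ - (τ - 1ℤ)) (∑-const m (τ - 1ℤ))) (id₂ M τ)))
          where
          id₁ : ∀ T z → T ≡ T + z - z
          id₁ = solve-∀
          id₂ : ∀ M τ → M * (τ - 1ℤ) + τ - (τ - 1ℤ) ≡ M * τ - M + 1ℤ
          id₂ = solve-∀

        -- The `δ + 1` points of a line lie on at most `δ + 1` of the vectors each, so the left side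
        -- is nonnegative; by `large` the right side is at most 0. Hence both vanish, which fixes
        -- `M` and the column sum at every point of a line.
        slack-sum : ∀ j → j ≢ i₀ → (∑ λ p → x j p * (δ + 1ℤ - e p)) ≡ δ * δ + δ + + 2 - M
        slack-sum j j≢i₀ = begin
          (∑ λ p → x j p * (δ + 1ℤ - e p))
            ≡⟨ ∑-cong (λ p → id₁ (x j p) (e p) (δ + 1ℤ)) ⟩
          (∑ λ p → (δ + 1ℤ) * x j p - e p * x j p)
            ≡⟨ ∑-- (λ p → (δ + 1ℤ) * x j p) (λ p → e p * x j p) ⟩
          (∑ λ p → (δ + 1ℤ) * x j p) - e · x j
            ≡⟨ cong₂ _-_ (trans (∑-*ˡ (δ + 1ℤ) (x j)) (cong ((δ + 1ℤ) *_) (∑x j))) (e·x j) ⟩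
          (δ + 1ℤ) * (g - + 2 * t j + δ) - (M * (g - t j) - T + δ)
            ≡⟨ cong₂ _-_ (cong₂ (λ u v → (δ + 1ℤ) * (u - + 2 * v + δ)) g≡ (t≡ j j≢i₀))
                 (cong₂ (λ u v → M * u - v + δ) (cong₂ _-_ g≡ (t≡ j j≢i₀)) T≡) ⟩
          (δ + 1ℤ) * (+ 2 * τ - 1ℤ - + 2 * (τ - 1ℤ) + δ) - (M * (+ 2 * τ - 1ℤ - (τ - 1ℤ)) - (M * τ - M + 1ℤ) + δ)
            ≡⟨ id₂ δ τ M ⟩
          δ * δ + δ + + 2 - M ∎
          where
          open ≡-Reasoning
          id₁ : ∀ x e d → x * (d - e) ≡ d * x - e * x
          id₁ = solve-∀
          id₂ : ∀ δ τ M → (δ + 1ℤ) * (+ 2 * τ - 1ℤ - + 2 * (τ - 1ℤ) + δ) - (M * (+ 2 * τ - 1ℤ - (τ - 1ℤ)) - (M * τ - M + 1ℤ) + δ)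
            ≡ δ * δ + δ + + 2 - M
          id₂ = solve-∀

        slack-nonneg : ∀ j p → 0ℤ ≤ x j p * (δ + 1ℤ - e p)
        slack-nonneg j p = 0≤x j p ⊗ diff (≤-trans (e≤E p) E≤δ+1)

        slack≡0 : ∀ j → j ≢ i₀ → ∀ p → x j p * (δ + 1ℤ - e p) ≡ 0ℤ
        slack≡0 j j≢i₀ = ∑≤0⇒term≡0 (slack-nonneg j)
          (subst (_≤ 0ℤ) (sym (slack-sum j j≢i₀)) (ℤ.i≤j⇒i-j≤0 large))

        M≡ : M ≡ δ * δ + δ + + 2
        M≡ = let j , j≢i₀ = another i₀ (≤-trans (+≤+ (ℕ.s≤s (ℕ.s≤s ℕ.z≤n))) 4≤M) in
          ≤-antisym (ℤ.0≤i-j⇒j≤i (subst (0ℤ ≤_) (slack-sum j j≢i₀) (∑-nonneg (slack-nonneg j)))) large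

        -- The inner product is half of `y i₀ + y j`, and these values are -1 and 1.
        disjoint : ∀ j → j ≢ i₀ → ∀ p → x i₀ p * x j p ≡ 0ℤ
        disjoint j j≢i₀ = ∑≤0⇒term≡0 (λ p → 0≤x i₀ p ⊗ 0≤x j p) (≤-reflexive
          (trans (x·x′ i₀ j j≢i₀) (trans (cong₂ (λ u v → u - τ - v) g≡ (t≡ j j≢i₀)) (id₁ τ))))
          where
          id₁ : ∀ τ → + 2 * τ - 1ℤ - τ - (τ - 1ℤ) ≡ 0ℤ
          id₁ = solve-∀

        h : Vector ℤ N
        h p = e p - x i₀ p

        -- `h p` counts the lines through `p`. A point on some line lies on `δ + 1` vectors, none of
        -- which is `x i₀` by `disjoint`; any other point has count 0.
        δ+1∣h : ∀ p → ∃ λ z → h p ≡ (δ + 1ℤ) * z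
        δ+1∣h p with Fin.any? (λ j → ¬? (j Fin.≟ i₀) ×-dec ¬? (x j p ℤ.≟ 0ℤ))
        ... | yes (j , j≢i₀ , xj≢0) = 1ℤ , trans (cong₂ _-_ e≡ x₀≡0) (id₁ δ)
          where
          id₁ : ∀ δ → δ + 1ℤ - 0ℤ ≡ (δ + 1ℤ) * 1ℤ
          id₁ = solve-∀
          e≡ : e p ≡ δ + 1ℤ
          e≡ = case ℤ.i*j≡0⇒i≡0∨j≡0 (x j p) (slack≡0 j j≢i₀ p) of λ where
            (inj₁ xj≡0) → contradiction xj≡0 xj≢0
            (inj₂ eq)   → sym (≡-of-diff eq)
          x₀≡0 : x i₀ p ≡ 0ℤ
          x₀≡0 = case ℤ.i*j≡0⇒i≡0∨j≡0 (x i₀ p) (disjoint j j≢i₀ p) of λ where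
            (inj₁ x₀≡0) → x₀≡0
            (inj₂ xj≡0) → contradiction xj≡0 xj≢0
        ... | no none = 0ℤ , trans (cong (_- x i₀ p) e≡x₀) (id₂ (x i₀ p) δ)
          where
          id₂ : ∀ x δ → x - x ≡ (δ + 1ℤ) * 0ℤ
          id₂ = solve-∀
          e≡x₀ : e p ≡ x i₀ p
          e≡x₀ = begin
            e p                     ≡⟨ ℤ.+-identityʳ (e p) ⟨
            e p + 0ℤ
              ≡⟨ ∑-except i₀ {λ j → x j p} {λ _ → 0ℤ} (λ j j≢i₀ → decidable-stable (x j p ℤ.≟ 0ℤ) λ xj≢0 → none (j , j≢i₀ , xj≢0)) ⟩
            (∑ {m} λ _ → 0ℤ) + x i₀ p   ≡⟨ cong (_+ x i₀ p) (trans (∑-const m 0ℤ) (ℤ.*-zeroʳ M)) ⟩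
            0ℤ + x i₀ p             ≡⟨ ℤ.+-identityˡ (x i₀ p) ⟩
            x i₀ p                  ∎
            where open ≡-Reasoning

        c·h : c · h ≡ (M - 1ℤ) * τ
        c·h = begin
          c · h                                  ≡⟨ ∑-cong (λ p → id₁ (c p) (e p) (x i₀ p)) ⟩
          (∑ λ p → c p * e p - c p * x i₀ p)     ≡⟨ ∑-- (λ p → c p * e p) (λ p → c p * x i₀ p) ⟩
          c · e - c · x i₀                       ≡⟨ cong₂ _-_ c·e (c·x i₀) ⟩
          g * M - T - (g - τ)                    ≡⟨ cong₂ (λ u v → u * M - v - (u - τ)) g≡ T≡ ⟩
          (+ 2 * τ - 1ℤ) * M - (M * τ - M + 1ℤ) - (+ 2 * τ - 1ℤ - τ) ≡⟨ id₂ M τ ⟩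
          (M - 1ℤ) * τ                           ∎
          where
          open ≡-Reasoning
          id₁ : ∀ c e x → c * (e - x) ≡ c * e - c * x
          id₁ = solve-∀
          id₂ : ∀ M τ → (+ 2 * τ - 1ℤ) * M - (M * τ - M + 1ℤ) - (+ 2 * τ - 1ℤ - τ) ≡ (M - 1ℤ) * τ
          id₂ = solve-∀

        -- Since `δ² + δ + 1` is `(δ + 1) δ + 1`, taking `δ * τ` away from the quotient of `c · h`
        -- by `δ + 1` leaves the quotient of `τ`.
        quotient : ℤ
        quotient = (∑ λ p → c p * proj₁ (δ+1∣h p)) - δ * τ

        τ≡ : τ ≡ (δ + 1ℤ) * quotient
        τ≡ = begin
          τ                                             ≡⟨ id₁ δ τ ⟩
          (δ * δ + δ + + 2 - 1ℤ) * τ - (δ + 1ℤ) * (δ * τ) ≡⟨ cong (λ z → (z - 1ℤ) * τ - (δ + 1ℤ) * (δ * τ)) M≡ ⟨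
          (M - 1ℤ) * τ - (δ + 1ℤ) * (δ * τ)             ≡⟨ cong (_- (δ + 1ℤ) * (δ * τ)) c·h ⟨
          c · h - (δ + 1ℤ) * (δ * τ)
            ≡⟨ cong (_- (δ + 1ℤ) * (δ * τ)) (trans (∑-cong λ p → trans (cong (c p *_) (proj₂ (δ+1∣h p))) (id₂ (c p) δ (proj₁ (δ+1∣h p)))) (∑-*ˡ (δ + 1ℤ) (λ p → c p * proj₁ (δ+1∣h p)))) ⟩
          (δ + 1ℤ) * (∑ λ p → c p * proj₁ (δ+1∣h p)) - (δ + 1ℤ) * (δ * τ)
            ≡⟨ id₃ (∑ λ p → c p * proj₁ (δ+1∣h p)) δ (δ * τ) ⟩
          (δ + 1ℤ) * quotient                           ∎
          where
          open ≡-Reasoning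
          id₁ : ∀ δ τ → τ ≡ (δ * δ + δ + + 2 - 1ℤ) * τ - (δ + 1ℤ) * (δ * τ)
          id₁ = solve-∀
          id₂ : ∀ c δ z → c * ((δ + 1ℤ) * z) ≡ (δ + 1ℤ) * (c * z)
          id₂ = solve-∀
          id₃ : ∀ S δ w → (δ + 1ℤ) * S - (δ + 1ℤ) * w ≡ (δ + 1ℤ) * (S - w)
          id₃ = solve-∀

        -- The set `c` meets the exceptional vector `x i₀` in `τ - 1ℤ` points.
        1≤τ : 1ℤ ≤ τ
        1≤τ = from-diff _ (∑-nonneg (λ p → 0≤c p ⊗ 0≤x i₀ p))
          (trans (id₁ τ) (trans (cong (_- τ) (sym g≡)) (sym (c·x i₀))))
          where
          id₁ : ∀ τ → τ - 1ℤ ≡ + 2 * τ - 1ℤ - τ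
          id₁ = solve-∀

        impossible : ⊥
        impossible = no-multiple quotient (subst (1ℤ ≤_) τ≡ 1≤τ) (subst (_≤ δ) τ≡ (t≤δ i₀))
          where
          id₁ : ∀ δ w → ((δ + 1ℤ) * w - 1ℤ) + (δ + 1ℤ) * (0ℤ - w) ≡ - 1ℤ
          id₁ = solve-∀
          id₂ : ∀ δ w → (δ - (δ + 1ℤ) * w) + (δ + 1ℤ) * (w - 1ℤ) ≡ - 1ℤ
          id₂ = solve-∀
          no-multiple : ∀ w → 1ℤ ≤ (δ + 1ℤ) * w → (δ + 1ℤ) * w ≤ δ → ⊥
          no-multiple w 1≤ ≤δ with w ℤ.≤? 0ℤ
          ... | yes w≤0 = absurd (diff 1≤ ⊕ (0≤δ ⊕ 0≤n {1}) ⊗ diff w≤0) (id₁ δ w)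
          ... | no w≰0  = absurd (diff ≤δ ⊕ (0≤δ ⊕ 0≤n {1}) ⊗ diff (≰⇒1+≤ {w} {0ℤ} w≰0)) (id₂ δ w)

      -- A nonzero `y b` is refuted first: it would leave few indices with value 0, and all others
      -- contribute at least 2 to `Y`. Once all `y i` vanish, the column sums are 0 or 1, and
      -- counting inside `c` gives `τ ≡ 0ℤ`.
      module Disjoint (i₀ : Fin m) (y₀ : y i₀ ≡ 0ℤ) where

        τ : ℤ
        τ = t i₀

        g≡ : g ≡ + 2 * τ
        g≡ = ≡-of-diff y₀

        0≤y : ∀ i → 0ℤ ≤ y i
        0≤y i with i Fin.≟ i₀
        ... | yes refl = ≤-reflexive (sym y₀)
        ... | no i≢i₀  = subst (0ℤ ≤_) (trans (cong (_+ y i) y₀) (ℤ.+-identityˡ (y i))) (pair-nonneg i₀ i i≢i₀)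

        -- Each `y i` is even because `g` is.
        2≤y : ∀ i → y i ≢ 0ℤ → + 2 ≤ y i
        2≤y i y≢0 = subst (+ 2 ≤_) (sym y≡) (even (τ - t i)
          (subst (0ℤ ≤_) y≡ (0≤y i)) (λ 2d≡0 → y≢0 (trans y≡ 2d≡0)))
          where
          id₁ : ∀ τ t → + 2 * τ - + 2 * t ≡ + 2 * (τ - t)
          id₁ = solve-∀
          y≡ : y i ≡ + 2 * (τ - t i)
          y≡ = trans (cong (_- + 2 * t i) g≡) (id₁ τ (t i))
          even : ∀ d → 0ℤ ≤ + 2 * d → + 2 * d ≢ 0ℤ → + 2 ≤ + 2 * d
          even (+ 0)         _ 2d≢0 = contradiction refl 2d≢0
          even (+ ℕ.suc d)   _ _    = ℤ.*-monoˡ-≤-nonNeg (+ 2) {1ℤ} {+ ℕ.suc d} (+≤+ (ℕ.s≤s ℕ.z≤n))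
          even -[1+ d ]      () _

        module _ (b : Fin m) (yb≢0 : y b ≢ 0ℤ) where

          zeros : Vector ℤ m
          zeros i with y i ℤ.≟ 0ℤ
          ... | yes _ = 1ℤ
          ... | no _  = 0ℤ

          W : ℤ
          W = ∑ zeros

          zeros-cases : ∀ i → (zeros i ≡ 1ℤ × y i ≡ 0ℤ) ⊎ (zeros i ≡ 0ℤ × y i ≢ 0ℤ)
          zeros-cases i with y i ℤ.≟ 0ℤ
          ... | yes y≡0 = inj₁ (refl , y≡0)
          ... | no y≢0  = inj₂ (refl , y≢0)

          zeros·zeros : zeros · zeros ≡ W
          zeros·zeros = ∑-cong λ i → case zeros-cases i of λ where
            (inj₁ (eq , _)) → subst (λ z → z * z ≡ z) (sym eq) refl
            (inj₂ (eq , _)) → subst (λ z → z * z ≡ z) (sym eq) refl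

          zeros-b : zeros b ≡ 0ℤ
          zeros-b = case zeros-cases b of λ where
            (inj₁ (_ , yb≡0)) → contradiction yb≡0 yb≢0
            (inj₂ (eq , _))   → eq

          zeros·t : zeros · t ≡ τ * W
          zeros·t = trans (∑-cong λ i → case zeros-cases i of λ where
              (inj₁ (_ , y≡0)) → trans (cong (zeros i *_) (t≡τ i y≡0)) (ℤ.*-comm (zeros i) τ)
              (inj₂ (eq , _))  → subst (λ z → z * t i ≡ τ * z) (sym eq) (sym (ℤ.*-zeroʳ τ)))
            (∑-*ˡ τ zeros)
            where
            t≡τ : ∀ i → y i ≡ 0ℤ → t i ≡ τ
            t≡τ i y≡0 = ℤ.*-cancelˡ-≡ (+ 2) (t i) τ (trans (sym (≡-of-diff y≡0)) g≡)

          w : Vector ℤ N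
          w = zeros ∙x

          w·w : w · w ≡ δ * W
          w·w = trans (norm-∙x zeros) (trans (cong₂ _+_ (cong₂ (λ u v → W * (u * W - + 2 * v)) g≡ zeros·t) (cong (δ *_) zeros·zeros))
            (id₁ τ W δ))
            where
            id₁ : ∀ τ W δ → W * (+ 2 * τ * W - + 2 * (τ * W)) + δ * W ≡ δ * W
            id₁ = solve-∀

          ∑w : ∑ w ≡ δ * W
          ∑w = trans (∑-∙x zeros) (trans (cong (_+ δ * W) (cong₂ (λ u v → u * W - + 2 * v) g≡ zeros·t)) (id₁ τ W δ))
            where
            id₁ : ∀ τ W δ → (+ 2 * τ * W - + 2 * (τ * W)) + δ * W ≡ δ * W
            id₁ = solve-∀

          2w·xb : + 2 * (w · x b) ≡ y b * W
          2w·xb = trans (cong (+ 2 *_) (trans (∙x-· zeros b) (cong₂ (λ u v → W * (g - t b) - u + δ * v) zeros·t zeros-b)))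
            (trans (cong (λ z → + 2 * (W * (z - t b) - τ * W + δ * 0ℤ)) g≡)
              (trans (id₁ W τ (t b) δ) (cong (λ z → (z - + 2 * t b) * W) (sym g≡))))
            where
            id₁ : ∀ W τ t δ → + 2 * (W * (+ 2 * τ - t) - τ * W + δ * 0ℤ) ≡ (+ 2 * τ - + 2 * t) * W
            id₁ = solve-∀

          -- The vectors x i with y i = 0 are pairwise disjoint and meet x b in y b / 2 places each, so they are
          -- few; the integer inequality z² + z ≥ 0 at z = x b - w counts this without splitting into supports.
          few-zeros : y b * W ≤ + 2 * (y b + δ)
          few-zeros = ℤ.0≤i-j⇒j≤i (begin
            0ℤ
              ≤⟨ ∑-nonneg (λ p → square-+-nonneg (x b p - w p)) ⟩
            (∑ λ p → (x b p - w p) * (x b p - w p) + (x b p - w p))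
              ≡⟨ ∑-cong (λ p → id₁ (x b p) (w p)) ⟩
            (∑ λ p → (x b p * x b p + x b p) + (w p * w p - w p - + 2 * (w p * x b p)))
              ≡⟨ ∑-+ (λ p → x b p * x b p + x b p) (λ p → w p * w p - w p - + 2 * (w p * x b p)) ⟩
            (∑ λ p → x b p * x b p + x b p) + (∑ λ p → w p * w p - w p - + 2 * (w p * x b p))
              ≡⟨ cong₂ _+_ (∑-+ (λ p → x b p * x b p) (x b))
                   (trans (∑-- (λ p → w p * w p - w p) (λ p → + 2 * (w p * x b p)))
                     (cong₂ _-_ (∑-- (λ p → w p * w p) w) (∑-*ˡ (+ 2) (λ p → w p * x b p)))) ⟩
            (x b · x b + ∑ (x b)) + (w · w - ∑ w - + 2 * (w · x b))
              ≡⟨ cong₂ _+_ (cong₂ _+_ (x·x b) (∑x b)) (cong₂ _-_ (cong₂ _-_ w·w ∑w) 2w·xb) ⟩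
            ((y b + δ) + (y b + δ)) + (δ * W - δ * W - y b * W)
              ≡⟨ id₂ (y b + δ) (δ * W) (y b * W) ⟩
            + 2 * (y b + δ) - y b * W ∎)
            where
            open ℤ.≤-Reasoning
            id₁ : ∀ x w → (x - w) * (x - w) + (x - w) ≡ (x * x + x) + (w * w - w - + 2 * (w * x))
            id₁ = solve-∀
            id₂ : ∀ a b c → (a + a) + (b - b - c) ≡ + 2 * a - c
            id₂ = solve-∀

          -- Division of `few-zeros` by `y b` gives `W ≤ 2 + 2 δ / y b`, and `y b` is at least 2.
          W≤ : W ≤ δ + + 2
          W≤ = decidable-stable (W ℤ.≤? δ + + 2) λ W≰ → absurd
            (diff few-zeros ⊕ 0≤y b ⊗ diff (≰⇒1+≤ {W} {δ + + 2} W≰) ⊕ diff (2≤y b yb≢0) ⊗ (0≤δ ⊕ 0≤n {1}) ⊕ 0≤n {1}) (id₁ (y b) W δ)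
            where
            id₁ : ∀ y W δ → (+ 2 * (y + δ) - y * W) + y * (W - (δ + + 2 + 1ℤ)) + (y - + 2) * (δ + 1ℤ) + + 1 ≡ - 1ℤ
            id₁ = solve-∀

          2[M-W]≤Y : + 2 * (M - W) ≤ Y
          2[M-W]≤Y = begin
            + 2 * (M - W)                     ≡⟨ cong (λ z → + 2 * (z - W)) ∑ones ⟨
            + 2 * (∑ ones - ∑ zeros)          ≡⟨ cong (+ 2 *_) (∑-- ones zeros) ⟨
            + 2 * (∑ λ i → 1ℤ - zeros i)      ≡⟨ ∑-*ˡ (+ 2) (λ i → 1ℤ - zeros i) ⟨
            (∑ λ i → + 2 * (1ℤ - zeros i))    ≤⟨ ∑-mono-≤ termwise ⟩
            ∑ y                               ≡⟨ ∑y ⟩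
            Y                                 ∎
            where
            open ℤ.≤-Reasoning
            termwise : ∀ i → + 2 * (1ℤ - zeros i) ≤ y i
            termwise i = case zeros-cases i of λ where
              (inj₁ (eq , _))   → subst (λ z → + 2 * (1ℤ - z) ≤ y i) (sym eq) (0≤y i)
              (inj₂ (eq , y≢0)) → subst (λ z → + 2 * (1ℤ - z) ≤ y i) (sym eq) (2≤y i y≢0)

          2[M-δ-2]≤Y : + 2 * (M - (δ + + 2)) ≤ Y
          2[M-δ-2]≤Y = from-diff _ (diff 2[M-W]≤Y ⊕ 0≤n {2} ⊗ diff W≤) (id₁ M W δ Y)
            where
            id₁ : ∀ M W δ Y → Y - + 2 * (M - (δ + + 2)) ≡ (Y - + 2 * (M - W)) + + 2 * (δ + + 2 - W)
            id₁ = solve-∀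

          2≤Y : + 2 ≤ Y
          2≤Y = ≤-trans (2≤y b yb≢0) (subst (y b ≤_) ∑y (term≤∑ 0≤y b))

          impossible : ⊥
          impossible = case Y-cases of λ where
            (inj₁ (_ , Y≤0))   → case ≤-trans 2≤Y Y≤0 of λ { (+≤+ ()) }
            (inj₂ (2≤δ , Y<M)) → norm-contradiction Y<M 2[M-δ-2]≤Y large 2≤δ

        y≡0 : ∀ i → y i ≡ 0ℤ
        y≡0 i = decidable-stable (y i ℤ.≟ 0ℤ) (impossible i)

        t≡τ : ∀ i → t i ≡ τ
        t≡τ i = ℤ.*-cancelˡ-≡ (+ 2) (t i) τ (trans (sym (≡-of-diff (y≡0 i))) g≡)

        T≡ : T ≡ M * τ
        T≡ = trans (∑-cong t≡τ) (∑-const m τ)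

        Y≡0 : Y ≡ 0ℤ
        Y≡0 = trans (sym ∑y) (trans (∑-cong y≡0) (trans (∑-const m 0ℤ) (ℤ.*-zeroʳ M)))

        -- With `Y ≡ 0ℤ` the column sums and their squares have the same total. For integers each
        -- square is at least the number itself, so equality holds in every column.
        e-idem : ∀ p → e p * e p ≡ e p
        e-idem p = ≡-of-diff (∑≤0⇒term≡0 {f = λ p → e p * e p - e p}
          (λ p → subst (0ℤ ≤_) (id₁ (e p)) (square-+-nonneg (- e p)))
          (≤-reflexive (trans (∑-- (λ p → e p * e p) e) (trans (cong₂ _-_ e·e ∑e)
            (trans (cong (λ z → M * z + δ * M - (z + δ * M)) Y≡0) (id₂ M (δ * M)))))) p)
          where
          id₁ : ∀ e → (- e) * (- e) + (- e) ≡ e * e - e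
          id₁ = solve-∀
          id₂ : ∀ M z → M * 0ℤ + z - (0ℤ + z) ≡ 0ℤ
          id₂ = solve-∀

        e≤1 : ∀ p → e p ≤ 1ℤ
        e≤1 p = from-diff _ (square-nonneg (1ℤ - e p)) (trans (id₁ (e p)) (trans (cong (λ z → 1ℤ - e p - e p + z) (sym (e-idem p))) (id₂ (e p))))
          where
          id₁ : ∀ e → 1ℤ - e ≡ 1ℤ - e - e + e
          id₁ = solve-∀
          id₂ : ∀ e → 1ℤ - e - e + e * e ≡ (1ℤ - e) * (1ℤ - e)
          id₂ = solve-∀

        c·x≡τ : ∀ i → c · x i ≡ τ
        c·x≡τ i = trans (c·x i) (trans (cong₂ _-_ g≡ (t≡τ i)) (id₁ τ))
          where
          id₁ : ∀ τ → + 2 * τ - τ ≡ τ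
          id₁ = solve-∀

        -- The `x i` are disjoint and each of them meets `c` in `τ` points, so together they occupy
        -- `M * τ` points of `c`.
        M*τ≤ : M * τ ≤ ℓ + + 2 * τ
        M*τ≤ = begin
          M * τ                ≡⟨ id₁ M τ ⟩
          + 2 * τ * M - M * τ  ≡⟨ cong₂ (λ u v → u * M - v) g≡ T≡ ⟨
          g * M - T            ≡⟨ c·e ⟨
          c · e                ≤⟨ ∑-mono-≤ (λ p → from-diff _ (0≤c p ⊗ diff (e≤1 p)) (id₂ (c p) (e p))) ⟩
          ∑ c                  ≡⟨ trans ∑c (cong (λ z → ℓ + z) g≡) ⟩
          ℓ + + 2 * τ          ∎
          where
          open ℤ.≤-Reasoning
          id₁ : ∀ M τ → M * τ ≡ + 2 * τ * M - M * τ
          id₁ = solve-∀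
          id₂ : ∀ c e → c - c * e ≡ c * (1ℤ - e)
          id₂ = solve-∀

        -- By the preceding count `(M - 2) τ ≤ ℓ`, whereas `M - 2` is at least `ℓ + 1`.
        τ≡0 : τ ≡ 0ℤ
        τ≡0 = ≤-antisym
          (decidable-stable (τ ℤ.≤? 0ℤ) λ τ≰0 → let 1≤τ = ≰⇒1+≤ {τ} {0ℤ} τ≰0 in absurd
            (diff M*τ≤ ⊕ diff ℓ+3≤m ⊗ ≤-trans (+≤+ ℕ.z≤n) 1≤τ ⊕ 0≤ℓ ⊗ diff 1≤τ ⊕ diff 1≤τ) (id₁ M ℓ τ))
          (subst (0ℤ ≤_) (c·x≡τ i₀) (∑-nonneg λ p → 0≤c p ⊗ 0≤x i₀ p))
          where
          id₁ : ∀ M ℓ τ → (ℓ + + 2 * τ - M * τ) + (M - (ℓ + + 3)) * τ + ℓ * (τ - 1ℤ) + (τ - 1ℤ) ≡ - 1ℤ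
          id₁ = solve-∀

        cx≡0 : ∀ i p → c p * x i p ≡ 0ℤ
        cx≡0 i = ∑≤0⇒term≡0 (λ p → 0≤c p ⊗ 0≤x i p) (≤-reflexive (trans (c·x≡τ i) τ≡0))

    centred-sunflower : (∀ i p → c p * x i p ≡ 0ℤ) × (∀ p → (∑ λ i → x i p) ≤ 1ℤ)
    centred-sunflower = let i , yi≤0 = small in case near-0 yi≤0 (-1≤y i) of λ where
      (inj₁ yi≡0)  → Disjoint.cx≡0 i yi≡0 , Disjoint.e≤1 i yi≡0
      (inj₂ yi≡-1) → ⊥-elim (Plane.impossible i yi≡-1)

  -- Reduction of Deza's theorem to sparse families

  module Sunflower {m N : ℕ} (a : Fin m → Vector ℤ N) (ℓ δ : ℤ)
    (idem : ∀ i p → a i p * a i p ≡ a i p)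
    (a·a : ∀ i → a i · a i ≡ ℓ + δ)
    (a·b : ∀ i j → j ≢ i → a i · a j ≡ ℓ)
    (0≤ℓ : 0ℤ ≤ ℓ) (1≤δ : 1ℤ ≤ δ)
    (large : δ * δ + δ + + 2 ≤ + m) (ℓ+3≤m : ℓ + + 3 ≤ + m)
    where

    private
      M : ℤ
      M = + m

      r : Vector ℤ N
      r p = ∑ λ i → a i p

      bounded : ∃ (ColumnBound δ)
      bounded with δ ℤ.≤? 1ℤ
      ... | yes δ≤1 = 1ℤ , inj₁ (≤-antisym δ≤1 1≤δ , refl)
      ... | no δ≰1  = δ + 1ℤ , inj₂ (≰⇒1+≤ {δ} {1ℤ} δ≰1 , refl)

      E : ℤ
      E = proj₁ bounded

      opaque

        split : ∀ p → ∃ λ c → (c ≡ 0ℤ × r p ≤ E) ⊎ (c ≡ 1ℤ × M - r p ≤ E)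
        split p = case few-or-almost-all a ℓ δ a·a a·b idem p (proj₂ bounded) large of λ where
          (inj₁ few)    → 0ℤ , inj₁ (refl , few)
          (inj₂ almost) → 1ℤ , inj₂ (refl , almost)

      c : Vector ℤ N
      c p = proj₁ (split p)

      -- Complementing the columns that are almost full makes all columns sparse.
      x : Fin m → Vector ℤ N
      x i p = a i p + c p - + 2 * (a i p * c p)

      c-idem : ∀ p → c p * c p ≡ c p
      c-idem p with split p
      ... | _ , inj₁ (refl , _) = refl
      ... | _ , inj₂ (refl , _) = refl

      c≤1 : ∀ p → c p ≤ 1ℤ
      c≤1 p with split p
      ... | _ , inj₁ (refl , _) = +≤+ ℕ.z≤n
      ... | _ , inj₂ (refl , _) = ≤-refl

      0≤a : ∀ i p → 0ℤ ≤ a i p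
      0≤a i p = subst (0ℤ ≤_) (idem i p) (square-nonneg (a i p))

      -- Complementing turns `a i · a j` into `a i · a j + ∑ c - c · a i - c · a j`. Shifting
      -- `c · a i` and `∑ c` by `ℓ` absorbs the constant, so that off the diagonal this is
      -- `g - t i - t j`.
      t : Vector ℤ m
      t i = c · a i - ℓ

      g : ℤ
      g = ∑ c - ℓ

      x·x : ∀ i j → x i · x j ≡ a i · a j + ∑ c - c · a i - c · a j
      x·x i j = begin
        x i · x j
          ≡⟨ ∑-cong (λ p → trans (id₁ (a i p) (a j p) (c p)) (trans (cong (λ z → a i p * a j p + (a i p + a j p) * c p - + 4 * (a i p * a j p * c p)
               + (1ℤ - + 2 * a i p - + 2 * a j p + + 4 * (a i p * a j p)) * z) (c-idem p)) (id₂ (a i p) (a j p) (c p)))) ⟩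
        (∑ λ p → a i p * a j p + c p - c p * a i p - c p * a j p)
          ≡⟨ ∑-- (λ p → a i p * a j p + c p - c p * a i p) (λ p → c p * a j p) ⟩
        (∑ λ p → a i p * a j p + c p - c p * a i p) - c · a j
          ≡⟨ cong (_- c · a j) (∑-- (λ p → a i p * a j p + c p) (λ p → c p * a i p)) ⟩
        (∑ λ p → a i p * a j p + c p) - c · a i - c · a j
          ≡⟨ cong (λ z → z - c · a i - c · a j) (∑-+ (λ p → a i p * a j p) c) ⟩
        a i · a j + ∑ c - c · a i - c · a j ∎
        where
        open ≡-Reasoning
        id₁ : ∀ a b c → (a + c - + 2 * (a * c)) * (b + c - + 2 * (b * c)) ≡
          a * b + (a + b) * c - + 4 * (a * b * c) + (1ℤ - + 2 * a - + 2 * b + + 4 * (a * b)) * (c * c)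
        id₁ = solve-∀
        id₂ : ∀ a b c → a * b + (a + b) * c - + 4 * (a * b * c) + (1ℤ - + 2 * a - + 2 * b + + 4 * (a * b)) * c ≡
          a * b + c - c * a - c * b
        id₂ = solve-∀

      x-idem : ∀ i p → x i p * x i p ≡ x i p
      x-idem i p = trans (id₁ (a i p) (c p)) (trans (cong₂ (λ u v → u + v + + 4 * (u * v) + + 2 * (a i p * c p)
          - + 4 * (u * c p) - + 4 * (a i p * v)) (idem i p) (c-idem p)) (id₂ (a i p) (c p)))
        where
        id₁ : ∀ a c → (a + c - + 2 * (a * c)) * (a + c - + 2 * (a * c)) ≡
          a * a + c * c + + 4 * (a * a * (c * c)) + + 2 * (a * c) - + 4 * (a * a * c) - + 4 * (a * (c * c))
        id₁ = solve-∀
        id₂ : ∀ a c → a + c + + 4 * (a * c) + + 2 * (a * c) - + 4 * (a * c) - + 4 * (a * c) ≡ a + c - + 2 * (a * c)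
        id₂ = solve-∀

      c·x : ∀ i → c · x i ≡ g - t i
      c·x i = begin
        c · x i
          ≡⟨ ∑-cong (λ p → trans (id₁ (a i p) (c p)) (trans (cong (λ z → c p * a i p + z - + 2 * (a i p * z)) (c-idem p)) (id₂ (a i p) (c p)))) ⟩
        (∑ λ p → c p - c p * a i p)       ≡⟨ ∑-- c (λ p → c p * a i p) ⟩
        ∑ c - c · a i                     ≡⟨ id₃ (∑ c) (c · a i) ℓ ⟩
        g - t i                           ∎
        where
        open ≡-Reasoning
        id₁ : ∀ a c → c * (a + c - + 2 * (a * c)) ≡ c * a + c * c - + 2 * (a * (c * c))
        id₁ = solve-∀
        id₂ : ∀ a c → c * a + c - + 2 * (a * c) ≡ c - c * a
        id₂ = solve-∀
        id₃ : ∀ C A ℓ → C - A ≡ C - ℓ - (A - ℓ)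
        id₃ = solve-∀

      gram-self : ∀ i → x i · x i ≡ g - + 2 * t i + δ
      gram-self i = trans (x·x i i) (trans (cong (λ z → z + ∑ c - c · a i - c · a i) (a·a i)) (id₁ (∑ c) (c · a i) ℓ δ))
        where
        id₁ : ∀ C A ℓ δ → ℓ + δ + C - A - A ≡ (C - ℓ) - + 2 * (A - ℓ) + δ
        id₁ = solve-∀

      gram-other : ∀ i j → j ≢ i → x i · x j ≡ g - t i - t j
      gram-other i j j≢i = trans (x·x i j) (trans (cong (λ z → z + ∑ c - c · a i - c · a j) (a·b i j j≢i)) (id₁ (∑ c) (c · a i) (c · a j) ℓ))
        where
        id₁ : ∀ C A B ℓ → ℓ + C - A - B ≡ (C - ℓ) - (A - ℓ) - (B - ℓ)
        id₁ = solve-∀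

      ∑c : ∑ c ≡ ℓ + g
      ∑c = id₁ (∑ c) ℓ
        where
        id₁ : ∀ C ℓ → C ≡ ℓ + (C - ℓ)
        id₁ = solve-∀

      -- The set `c` contains at most all of the `ℓ + δ` ones of `a i`.
      t≤δ : ∀ i → t i ≤ δ
      t≤δ i = from-diff _ (diff (∑-mono-≤ {f = λ p → c p * a i p} {a i} λ p → from-diff _ (0≤a i p ⊗ diff (c≤1 p)) (id₁ (a i p) (c p))))
        (trans (id₂ ℓ δ (c · a i)) (cong (_- c · a i) (trans (sym (a·a i)) (∑-cong (idem i)))))
        where
        id₁ : ∀ a c → a - c * a ≡ a * (1ℤ - c)
        id₁ = solve-∀
        id₂ : ∀ ℓ δ A → δ - (A - ℓ) ≡ ℓ + δ - A
        id₂ = solve-∀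

      ∑x : ∀ p → (∑ λ i → x i p) ≡ r p + M * c p - + 2 * (c p * r p)
      ∑x p = begin
        (∑ λ i → a i p + c p - + 2 * (a i p * c p))
          ≡⟨ ∑-- (λ i → a i p + c p) (λ i → + 2 * (a i p * c p)) ⟩
        (∑ λ i → a i p + c p) - (∑ λ i → + 2 * (a i p * c p))
          ≡⟨ cong₂ _-_ (trans (∑-+ (λ i → a i p) (λ _ → c p)) (cong (λ z → r p + z) (∑-const m (c p))))
               (trans (∑-*ˡ (+ 2) (λ i → a i p * c p)) (cong (+ 2 *_) (trans (∑-cong λ i → ℤ.*-comm (a i p) (c p)) (∑-*ˡ (c p) (λ i → a i p))))) ⟩
        r p + M * c p - + 2 * (c p * r p) ∎
        where open ≡-Reasoning

      complement-0 : ∀ r M → r + M * 0ℤ - + 2 * (0ℤ * r) ≡ r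
      complement-0 = solve-∀

      complement-1 : ∀ r M → r + M * 1ℤ - + 2 * (1ℤ * r) ≡ M - r
      complement-1 = solve-∀

      sparse : ∀ p → (∑ λ i → x i p) ≤ E
      sparse p = subst (_≤ E) (sym (∑x p)) (case proj₂ (split p) of λ where
        (inj₁ (c≡0 , few))    → subst (_≤ E) (trans (sym (complement-0 (r p) M)) (cong (λ z → r p + M * z - + 2 * (z * r p)) (sym c≡0))) few
        (inj₂ (c≡1 , almost)) → subst (_≤ E) (trans (sym (complement-1 (r p) M)) (cong (λ z → r p + M * z - + 2 * (z * r p)) (sym c≡1))) almost)

      opaque

        centred : (∀ i p → c p * x i p ≡ 0ℤ) × (∀ p → (∑ λ i → x i p) ≤ 1ℤ)
        centred = centred-sunflower x c t g ℓ δ E x-idem c-idem gram-self gram-other c·x ∑c t≤δ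
          0≤ℓ (proj₂ bounded) sparse large ℓ+3≤m

    -- Deza's theorem, stated column by column.
    full-or-sparse : ∀ p → (∀ i → a i p ≡ 1ℤ) ⊎ (∑ λ i → a i p) ≤ 1ℤ
    full-or-sparse p = by-cases (proj₂ (split p))
      where
      id₁ : ∀ a → 1ℤ - a ≡ 1ℤ * (a + 1ℤ - + 2 * (a * 1ℤ))
      id₁ = solve-∀
      by-cases : (c p ≡ 0ℤ × r p ≤ E) ⊎ (c p ≡ 1ℤ × M - r p ≤ E) → (∀ i → a i p ≡ 1ℤ) ⊎ r p ≤ 1ℤ
      by-cases (inj₁ (c≡0 , _)) = inj₂ (subst (_≤ 1ℤ)
        (trans (∑x p) (trans (cong (λ z → r p + M * z - + 2 * (z * r p)) c≡0) (complement-0 (r p) M)))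
        (proj₂ centred p))
      -- In a complemented column `x i p` is `1 - a i p`, and disjointness from `c` makes it 0.
      by-cases (inj₂ (c≡1 , _)) = inj₁ λ i → sym (≡-of-diff (trans (id₁ (a i p))
        (trans (cong (λ z → z * (a i p + z - + 2 * (a i p * z))) (sym c≡1)) (proj₁ centred i p))))

  private
    variable
      P : Set
      q : ℕ

  -- Encoding words by 0-1 vectors

  2≰1 : ¬ (+ 2 ≤ 1ℤ)
  2≰1 (+≤+ (ℕ.s≤s ()))

  ⟦_⟧ : Dec P → ℤ
  ⟦ P? ⟧ = if does P? then 1ℤ else 0ℤ

  ⟦⟧-yes : (P? : Dec P) → P → ⟦ P? ⟧ ≡ 1ℤ
  ⟦⟧-yes (yes _) _ = refl
  ⟦⟧-yes (no ¬p) p = contradiction p ¬p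

  ⟦⟧-no : (P? : Dec P) → ¬ P → ⟦ P? ⟧ ≡ 0ℤ
  ⟦⟧-no (yes p) ¬p = contradiction p ¬p
  ⟦⟧-no (no _)  _  = refl

  ⟦⟧≡1 : (P? : Dec P) → ⟦ P? ⟧ ≡ 1ℤ → P
  ⟦⟧≡1 (yes p) _  = p
  ⟦⟧≡1 (no _)  ()

  ⟦⟧-idem : (P? : Dec P) → ⟦ P? ⟧ * ⟦ P? ⟧ ≡ ⟦ P? ⟧
  ⟦⟧-idem (yes _) = refl
  ⟦⟧-idem (no _)  = refl

  0≤⟦⟧ : (P? : Dec P) → 0ℤ ≤ ⟦ P? ⟧
  0≤⟦⟧ (yes _) = +≤+ ℕ.z≤n
  0≤⟦⟧ (no _)  = ≤-refl

  ⟦⟧≤1 : (P? : Dec P) → ⟦ P? ⟧ ≤ 1ℤ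
  ⟦⟧≤1 (yes _) = ≤-refl
  ⟦⟧≤1 (no _)  = +≤+ ℕ.z≤n

  ∣tabulate∣ : {P : Fin n → Set} (P? : ∀ i → Dec (P i)) →
    + ∣ tabulate (does ∘ P?) ∣ ≡ ∑ λ i → ⟦ P? i ⟧
  ∣tabulate∣ {ℕ.zero}  P? = sym (∑-zero _)
  ∣tabulate∣ {ℕ.suc n} P? = trans (head (P? zero)) (sym (∑-suc _))
    where
    head : {A : Set} (d : Dec A) → + ∣ does d ∷ tabulate (does ∘ P? ∘ suc) ∣ ≡ ⟦ d ⟧ + ∑ λ i → ⟦ P? (suc i) ⟧
    head (yes _) = cong (λ z → 1ℤ + z) (∣tabulate∣ (P? ∘ suc))
    head (no _)  = trans (∣tabulate∣ (P? ∘ suc)) (sym (ℤ.+-identityˡ _))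

  ∈-tabulate⁻ : {P : Fin n → Set} (P? : ∀ i → Dec (P i)) → ∀ {i} → i ∈ tabulate (does ∘ P?) → P i
  ∈-tabulate⁻ P? {i} i∈ = true⇒ (P? i) (trans (sym (lookup∘tabulate (does ∘ P?) i)) ([]=⇒lookup i∈))
    where
    true⇒ : (d : Dec P) → does d ≡ true → P
    true⇒ (yes p) _  = p
    true⇒ (no _)  ()

  ∈-tabulate⁺ : {P : Fin n → Set} (P? : ∀ i → Dec (P i)) → ∀ {i} → P i → i ∈ tabulate (does ∘ P?)
  ∈-tabulate⁺ P? {i} p = lookup⇒[]= i _ (trans (lookup∘tabulate (does ∘ P?) i) (⇒true (P? i) p))
    where
    ⇒true : (d : Dec P) → P → does d ≡ true
    ⇒true (yes _) _ = refl
    ⇒true (no ¬p) p = contradiction p ¬p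

  x∈p─q⇒x∉q : ∀ {i} (s t : Subset n) → i ∈ s ─ t → i ∉ t
  x∈p─q⇒x∉q (_ ∷ s) (_ ∷ t) (there i∈) (there i∈t) = x∈p─q⇒x∉q s t i∈ i∈t
  x∈p─q⇒x∉q (inside  ∷ s) (inside ∷ t) () here
  x∈p─q⇒x∉q (outside ∷ s) (inside ∷ t) () here

  lookup-injective : ∀ {A : Set} {xs : List A} → Unique xs → ∀ {i j} → List.lookup xs i ≡ List.lookup xs j → i ≡ j
  lookup-injective (_ ∷ _)      {zero}  {zero}  _  = refl
  lookup-injective (x≢ ∷ _)     {zero}  {suc j} eq = contradiction eq (All.lookup x≢ (∈-lookup j))
  lookup-injective (x≢ ∷ _)     {suc i} {zero}  eq = contradiction (sym eq) (All.lookup x≢ (∈-lookup i))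
  lookup-injective (_ ∷ unique) {suc i} {suc j} eq = cong suc (lookup-injective unique eq)

  ∑-split : ∀ m {n} (f : Vector ℤ (m ℕ.+ n)) → ∑ f ≡ ∑ (λ i → f (i ↑ˡ n)) + ∑ (λ i → f (m ↑ʳ i))
  ∑-split ℕ.zero    f = trans (sym (ℤ.+-identityˡ (∑ f))) (cong (_+ ∑ f) (sym (∑-zero _)))
  ∑-split (ℕ.suc m) f = begin
    ∑ f                                   ≡⟨ ∑-suc f ⟩
    f zero + ∑ (f ∘ suc)                  ≡⟨ cong (λ z → f zero + z) (∑-split m (f ∘ suc)) ⟩
    f zero + (∑ (λ i → f (suc i ↑ˡ _)) + R) ≡⟨ ℤ.+-assoc (f zero) _ R ⟨
    f zero + ∑ (λ i → f (suc i ↑ˡ _)) + R ≡⟨ cong (_+ R) (∑-suc (λ i → f (i ↑ˡ _))) ⟨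
    ∑ (λ i → f (i ↑ˡ _)) + R              ∎
    where
    open ≡-Reasoning
    R = ∑ (λ i → f (ℕ.suc m ↑ʳ i))

  ∑-combine : ∀ n q (f : Vector ℤ (n ℕ.* q)) → ∑ f ≡ ∑ λ i → ∑ λ b → f (combine {n} {q} i b)
  ∑-combine ℕ.zero    q f = trans (∑-zero f) (sym (∑-zero _))
  ∑-combine (ℕ.suc n) q f = trans (∑-split q f)
    (trans (cong (λ z → ∑ (λ b → f (b ↑ˡ (n ℕ.* q))) + z) (∑-combine n q (λ p → f (q ↑ʳ p)))) (sym (∑-suc _)))

  ∑-zeros : {f : Vector ℤ n} → (∀ i → f i ≡ 0ℤ) → ∑ f ≡ 0ℤ
  ∑-zeros {n} f≡0 = trans (∑-cong f≡0) (trans (∑-const n 0ℤ) (ℤ.*-zeroʳ (+ n)))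

  nonzero? : (u : Fin q) → Dec (toℕ u ≢ 0)
  nonzero? u = ¬? (toℕ u ℕ.≟ 0)

  -- A symbol u is encoded by the 0-1 vector whose entry at 0 says whether u ≢ 0 and whose entry at b ≢ 0
  -- says whether u ≡ b: then the inner product of the encodings of two words determines their distance.
  encode : Fin q → Vector ℤ q
  encode u zero    = ⟦ nonzero? u ⟧
  encode u (suc b) = ⟦ u Fin.≟ suc b ⟧

  encode-idem : (u b : Fin q) → encode u b * encode u b ≡ encode u b
  encode-idem u zero    = ⟦⟧-idem (nonzero? u)
  encode-idem u (suc b) = ⟦⟧-idem (u Fin.≟ suc b)

  0≤encode : (u b : Fin q) → 0ℤ ≤ encode u b
  0≤encode u b = subst (0ℤ ≤_) (encode-idem u b) (square-nonneg (encode u b))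

  encode-self : (u : Fin q) → toℕ u ≢ 0 → encode u u ≡ 1ℤ
  encode-self zero    u≢0 = contradiction refl u≢0
  encode-self (suc u) _   = ⟦⟧-yes (suc u Fin.≟ suc u) refl

  encode≡1 : (u b : Fin q) → toℕ b ≢ 0 → encode u b ≡ 1ℤ → u ≡ b
  encode≡1 u zero    b≢0 _  = contradiction refl b≢0
  encode≡1 u (suc b) _   eq = ⟦⟧≡1 (u Fin.≟ suc b) eq

  indicator-· : (u v : Fin q) → (∑ λ b → ⟦ u Fin.≟ b ⟧ * ⟦ v Fin.≟ b ⟧) ≡ ⟦ u Fin.≟ v ⟧
  indicator-· zero    zero    = trans (∑-suc _) (cong (λ z → 1ℤ + z) (∑-zeros λ _ → refl))
  indicator-· zero    (suc v) = trans (∑-suc _) (cong (λ z → 0ℤ + z) (∑-zeros λ _ → refl))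
  indicator-· (suc u) zero    = trans (∑-suc _) (cong (λ z → 0ℤ + z) (∑-zeros λ b → ℤ.*-zeroʳ ⟦ suc u Fin.≟ suc b ⟧))
  indicator-· (suc u) (suc v) = trans (∑-suc _) (trans (ℤ.+-identityˡ _) (indicator-· u v))

  -- The symbol 0 is encoded by the zero vector, and distinct nonzero symbols share only the entry
  -- at 0.
  encode-· : (u v : Fin q) → encode u · encode v ≡ ⟦ nonzero? u ⟧ + ⟦ nonzero? v ⟧ - ⟦ ¬? (u Fin.≟ v) ⟧
  encode-· zero    zero    = trans (∑-suc _) (cong (λ z → 0ℤ + z) (∑-zeros λ _ → refl))
  encode-· zero    (suc v) = trans (∑-suc _) (cong (λ z → 0ℤ + z) (∑-zeros λ _ → refl))
  encode-· (suc u) zero    = trans (∑-suc _) (cong (λ z → 0ℤ + z) (∑-zeros λ b → ℤ.*-zeroʳ ⟦ suc u Fin.≟ suc b ⟧))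
  encode-· (suc u) (suc v) = trans (∑-suc _) (trans (cong (λ z → 1ℤ + z) (indicator-· u v)) (complement (u Fin.≟ v)))
    where
    complement : {A : Set} (d : Dec A) → 1ℤ + ⟦ d ⟧ ≡ 1ℤ + 1ℤ - ⟦ ¬? d ⟧
    complement (yes _) = refl
    complement (no _)  = refl

  module _ {q n : ℕ} where

    vector : Word q n → Vector ℤ (n ℕ.* q)
    vector x p = encode (lookup x (proj₁ (remQuot {n} q p))) (proj₂ (remQuot {n} q p))

    vector-combine : ∀ x i b → vector x (combine i b) ≡ encode (lookup x i) b
    vector-combine x i b = cong (λ z → encode (lookup x (proj₁ z)) (proj₂ z)) (Fin.remQuot-combine {n} {q} i b)

    vector-· : ∀ x y → vector x · vector y ≡ + wt x + + wt y - + d_H x y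
    vector-· x y = begin
      vector x · vector y
        ≡⟨ ∑-combine n q _ ⟩
      (∑ λ i → ∑ λ b → vector x (combine i b) * vector y (combine i b))
        ≡⟨ ∑-cong (λ i → trans (∑-cong λ b → cong₂ _*_ (vector-combine x i b) (vector-combine y i b)) (encode-· (lookup x i) (lookup y i))) ⟩
      (∑ λ i → ⟦ nonzero? (lookup x i) ⟧ + ⟦ nonzero? (lookup y i) ⟧ - ⟦ ¬? (lookup x i Fin.≟ lookup y i) ⟧)
        ≡⟨ ∑-- (λ i → ⟦ nonzero? (lookup x i) ⟧ + ⟦ nonzero? (lookup y i) ⟧) (λ i → ⟦ ¬? (lookup x i Fin.≟ lookup y i) ⟧) ⟩
      (∑ λ i → ⟦ nonzero? (lookup x i) ⟧ + ⟦ nonzero? (lookup y i) ⟧) - (∑ λ i → ⟦ ¬? (lookup x i Fin.≟ lookup y i) ⟧)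
        ≡⟨ cong (_- (∑ λ i → ⟦ ¬? (lookup x i Fin.≟ lookup y i) ⟧)) (∑-+ (λ i → ⟦ nonzero? (lookup x i) ⟧) (λ i → ⟦ nonzero? (lookup y i) ⟧)) ⟩
      (∑ λ i → ⟦ nonzero? (lookup x i) ⟧) + (∑ λ i → ⟦ nonzero? (lookup y i) ⟧) - (∑ λ i → ⟦ ¬? (lookup x i Fin.≟ lookup y i) ⟧)
        ≡⟨ cong₂ _-_ (cong₂ _+_ (∣tabulate∣ (λ i → nonzero? (lookup x i))) (∣tabulate∣ (λ i → nonzero? (lookup y i))))
             (∣tabulate∣ (λ i → ¬? (lookup x i Fin.≟ lookup y i))) ⟨
      + wt x + + wt y - + d_H x y ∎
      where open ≡-Reasoning

    d_H-self : ∀ (x : Word q n) → + d_H x x ≡ 0ℤ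
    d_H-self x = trans (∣tabulate∣ (λ i → ¬? (lookup x i Fin.≟ lookup x i)))
      (∑-zeros λ i → ⟦⟧-no (¬? (lookup x i Fin.≟ lookup x i)) λ ≢ → ≢ refl)

  -- The kernel of a large equidistant code of constant weight

  module LargeCode {q n : ℕ} (F : Code (ℕ.suc q) n) (k d : ℕ) (weight : ConstantWeight k F) (equidistant : Equidistant d F)
    (1≤d : 1 ℕ.≤ d) (d≤2k : d ℕ.≤ 2 ℕ.* k)
    -- With `l` equal to `k - d / 2`, the first two bounds say that the size exceeds
    -- `4 (k - l)² + 2 (k - l) + 1` and `2 l + 2`. The alphabet has `suc q` symbols, so the third
    -- says that the size exceeds the number of nonzero symbols.
    (large : d ℕ.* d ℕ.+ d ℕ.+ 2 ℕ.≤ size F) (2k+3≤m+d : 2 ℕ.* k ℕ.+ 3 ℕ.≤ size F ℕ.+ d) (q<m : q ℕ.< size F)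
    where

    private
      m : ℕ
      m = size F

      X : Fin m → Word (ℕ.suc q) n
      X = List.lookup (Code.words F)

      X∈F : ∀ j → X j ∈C F
      X∈F = ∈-lookup

      X-injective : ∀ {i j} → X i ≡ X j → i ≡ j
      X-injective = lookup-injective (Code.unique F)

      index : ∀ {x} → x ∈C F → ∃ λ j → X j ≡ x
      index x∈F = Any.index x∈F , sym (lookup-index x∈F)

      a : Fin m → Vector ℤ (n ℕ.* ℕ.suc q)
      a j = vector (X j)

      -- Twice the intersection size, hence an integer even before `d` is known to be even.
      ℓ : ℤ
      ℓ = + (2 ℕ.* k) - + d

      2k≡ : + k + + k ≡ + (2 ℕ.* k)
      2k≡ = cong (λ z → + (k ℕ.+ z)) (sym (ℕ.+-identityʳ k))

      a·a : ∀ i → a i · a i ≡ ℓ + + d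
      a·a i = trans (vector-· (X i) (X i)) (trans
        (cong₂ _-_ (trans (cong (λ z → + z + + z) (weight (X∈F i))) 2k≡) (d_H-self (X i))) (id₁ (+ (2 ℕ.* k)) (+ d)))
        where
        id₁ : ∀ x d → x - 0ℤ ≡ x - d + d
        id₁ = solve-∀

      a·b : ∀ i j → j ≢ i → a i · a j ≡ ℓ
      a·b i j j≢i = trans (vector-· (X i) (X j)) (cong₂ _-_
        (trans (cong₂ (λ u v → + u + + v) (weight (X∈F i)) (weight (X∈F j))) 2k≡)
        (cong +_ (equidistant (X∈F i) (X∈F j) (j≢i ∘ sym ∘ X-injective))))

      opaque

        full-or-sparse′ : ∀ p → (∀ j → a j p ≡ 1ℤ) ⊎ (∑ λ j → a j p) ≤ 1ℤ
        full-or-sparse′ = Sunflower.full-or-sparse a ℓ (+ d)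
          (λ j p → encode-idem (lookup (X j) (proj₁ (remQuot {n} (ℕ.suc q) p))) (proj₂ (remQuot {n} (ℕ.suc q) p)))
          a·a a·b (diff (+≤+ d≤2k)) (+≤+ 1≤d)
          (subst (_≤ + m) (cong (λ z → z + + d + + 2) (ℤ.pos-* d d)) (+≤+ large))
          (from-diff _ (diff (+≤+ 2k+3≤m+d)) (id₁ (+ (2 ℕ.* k)) (+ d) (+ m)))
          where
          id₁ : ∀ x d m → m - (x - d + + 3) ≡ m + d - (x + + 3)
          id₁ = solve-∀

      full-or-sparse : ∀ i b → (∀ j → encode (lookup (X j) i) b ≡ 1ℤ) ⊎ (∑ λ j → encode (lookup (X j) i) b) ≤ 1ℤ
      full-or-sparse i b = case full-or-sparse′ (combine i b) of λ where
        (inj₁ full)   → inj₁ λ j → trans (sym (vector-combine (X j) i b)) (full j)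
        (inj₂ sparse) → inj₂ (subst (_≤ 1ℤ) (∑-cong λ j → vector-combine (X j) i b) sparse)

      Full : Fin n → Set
      Full i = ∀ j → toℕ (lookup (X j) i) ≢ 0

      full? : ∀ i → Dec (Full i)
      full? i = Fin.all? λ j → nonzero? (lookup (X j) i)

      nz : Fin m → Fin n → ℤ
      nz j i = ⟦ nonzero? (lookup (X j) i) ⟧

      0≤nz : ∀ j i → 0ℤ ≤ nz j i
      0≤nz j i = 0≤⟦⟧ (nonzero? (lookup (X j) i))

      -- The encoding's entry at 0 records the support, so the dichotomy for that column applies.
      sparse : ∀ i → ¬ Full i → (∑ λ j → nz j i) ≤ 1ℤ
      sparse i ¬full = case full-or-sparse i zero of λ where
        (inj₁ full)   → contradiction (λ j → ⟦⟧≡1 (nonzero? (lookup (X j) i)) (full j)) ¬full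
        (inj₂ sparse) → sparse

      sparse-pair : ∀ i → ¬ Full i → ∀ {j k} → j ≢ k → nz j i + nz k i ≤ 1ℤ
      sparse-pair i ¬full j≢k = ≤-trans (two-terms≤∑ (λ l _ → 0≤nz l i) j≢k) (sparse i ¬full)

      -- There are more words than nonzero symbols, so two words share a symbol `b` at `i`. The
      -- column of `b` at `i` then has two entries 1 and must be full.
      constant : ∀ i → Full i → ∀ j k → lookup (X j) i ≡ lookup (X k) i
      constant i full j k = trans (all≡b j) (sym (all≡b k))
        where
        z≢X : ∀ j → zero ≢ lookup (X j) i
        z≢X j eq = full j (cong toℕ (sym eq))
        collision = Fin.pigeonhole q<m λ j → punchOut (z≢X j)
        j₁ j₂ : Fin m
        j₁ = proj₁ collision
        j₂ = proj₁ (proj₂ collision)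
        j₁≢j₂ : j₁ ≢ j₂
        j₁≢j₂ = Fin.<⇒≢ (proj₁ (proj₂ (proj₂ collision)))
        b : Fin (ℕ.suc q)
        b = lookup (X j₁) i
        b≡ : b ≡ lookup (X j₂) i
        b≡ = Fin.punchOut-injective (z≢X j₁) (z≢X j₂) (proj₂ (proj₂ (proj₂ collision)))
        all≡b : ∀ l → lookup (X l) i ≡ b
        all≡b l = case full-or-sparse i b of λ where
          (inj₁ all)    → encode≡1 (lookup (X l) i) b (full j₁) (all l)
          (inj₂ sparse) → ⊥-elim (2≰1 (≤-trans (subst₂ (λ u v → u + v ≤ (∑ λ j → encode (lookup (X j) i) b))
              (encode-self b (full j₁)) (trans (cong (λ u → encode u b) (sym b≡)) (encode-self b (full j₁)))
              (two-terms≤∑ {f = λ j → encode (lookup (X j) i) b} (λ j _ → 0≤encode (lookup (X j) i) b) j₁≢j₂)) sparse))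

    kernel : Subset n
    kernel = tabulate (does ∘ full?)

    kernel-constant : ∀ {x y} → x ∈C F → y ∈C F → x ≢ y → ∀ {i} → i ∈ kernel →
      lookup x i ≡ lookup y i × toℕ (lookup x i) ≢ 0
    kernel-constant x∈F y∈F _ {i} i∈D with index x∈F | index y∈F
    ... | j , refl | k , refl = let full = ∈-tabulate⁻ full? i∈D in constant i full j k , full j

    petals-disjoint : ∀ {x y} → x ∈C F → y ∈C F → x ≢ y → Empty ((supp x ─ kernel) ∩ (supp y ─ kernel))
    petals-disjoint x∈F y∈F x≢y (i , i∈) with index x∈F | index y∈F
    ... | j , refl | l , refl = 2≰1 (subst₂ (λ u v → u + v ≤ 1ℤ) (on j (proj₁ both)) (on l (proj₂ both))
        (sparse-pair i ¬full (x≢y ∘ cong X)))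
      where
      both = x∈p∩q⁻ (supp (X j) ─ kernel) (supp (X l) ─ kernel) i∈
      ¬full : ¬ Full i
      ¬full full = x∈p─q⇒x∉q (supp (X j)) kernel (proj₁ both) (∈-tabulate⁺ full? full)
      on : ∀ j → i ∈ supp (X j) ─ kernel → nz j i ≡ 1ℤ
      on j i∈ = ⟦⟧-yes (nonzero? (lookup (X j) i))
        (∈-tabulate⁻ (λ i → nonzero? (lookup (X j) i)) (p─q⊆p (supp (X j)) kernel i∈))

    private
      ∣kernel∣ : + ∣ kernel ∣ ≡ ∑ λ i → ⟦ full? i ⟧
      ∣kernel∣ = ∣tabulate∣ full?

      ∣supp∣ : ∀ j → (∑ λ i → nz j i) ≡ + k
      ∣supp∣ j = trans (sym (∣tabulate∣ λ i → nonzero? (lookup (X j) i))) (cong +_ (weight (X∈F j)))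

      -- At a kernel coordinate the words share a nonzero symbol, and both the support entry and the
      -- symbol entry contribute 1. Elsewhere at most one of the two words is nonzero.
      agreement : ∀ {j l} → j ≢ l → ∀ i → encode (lookup (X j) i) · encode (lookup (X l) i) ≡ + 2 * ⟦ full? i ⟧
      agreement {j} {l} j≢l i = trans (encode-· u v) (go (full? i) (toℕ u ℕ.≟ 0) (toℕ v ℕ.≟ 0))
        where
        u v : Fin (ℕ.suc q)
        u = lookup (X j) i
        v = lookup (X l) i
        go : (f : Dec (Full i)) → Dec (toℕ u ≡ 0) → Dec (toℕ v ≡ 0) →
          ⟦ nonzero? u ⟧ + ⟦ nonzero? v ⟧ - ⟦ ¬? (u Fin.≟ v) ⟧ ≡ + 2 * ⟦ f ⟧
        go (yes full) _ _ = cong₂ _-_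
          (cong₂ _+_ (⟦⟧-yes (nonzero? u) (full j)) (⟦⟧-yes (nonzero? v) (full l)))
          (⟦⟧-no (¬? (u Fin.≟ v)) λ u≢v → u≢v (constant i full j l))
        go (no ¬full) (yes u≡0) (yes v≡0) = cong₂ _-_
          (cong₂ _+_ (⟦⟧-no (nonzero? u) λ u≢0 → u≢0 u≡0) (⟦⟧-no (nonzero? v) λ v≢0 → v≢0 v≡0))
          (⟦⟧-no (¬? (u Fin.≟ v)) λ u≢v → u≢v (Fin.toℕ-injective (trans u≡0 (sym v≡0))))
        go (no ¬full) (yes u≡0) (no v≢0) = cong₂ _-_
          (cong₂ _+_ (⟦⟧-no (nonzero? u) λ u≢0 → u≢0 u≡0) (⟦⟧-yes (nonzero? v) v≢0))
          (⟦⟧-yes (¬? (u Fin.≟ v)) λ u≡v → v≢0 (trans (cong toℕ (sym u≡v)) u≡0))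
        go (no ¬full) (no u≢0) (yes v≡0) = cong₂ _-_
          (cong₂ _+_ (⟦⟧-yes (nonzero? u) u≢0) (⟦⟧-no (nonzero? v) λ v≢0 → v≢0 v≡0))
          (⟦⟧-yes (¬? (u Fin.≟ v)) λ u≡v → u≢0 (trans (cong toℕ u≡v) v≡0))
        go (no ¬full) (no u≢0) (no v≢0) = ⊥-elim (2≰1 (subst₂ (λ a b → a + b ≤ 1ℤ)
          (⟦⟧-yes (nonzero? u) u≢0) (⟦⟧-yes (nonzero? v) v≢0) (sparse-pair i ¬full j≢l)))

    -- The inner product of two distinct words is evaluated once by their distance and once
    -- coordinate by coordinate. The result makes `d` even, which is the integrality of `l`.
    kernel-size : 2 ℕ.* ∣ kernel ∣ ℕ.+ d ≡ 2 ℕ.* k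
    kernel-size = ℤ.+-injective (begin
      + (2 ℕ.* ∣ kernel ∣) + + d
        ≡⟨ cong (_+ + d) (trans (ℤ.pos-* 2 ∣ kernel ∣) (cong (+ 2 *_) ∣kernel∣)) ⟩
      + 2 * (∑ λ i → ⟦ full? i ⟧) + + d
        ≡⟨ cong (_+ + d) (trans (∑-cong (λ i → agreement j≢l i)) (∑-*ˡ (+ 2) (λ i → ⟦ full? i ⟧))) ⟨
      (∑ λ i → encode (lookup (X j) i) · encode (lookup (X l) i)) + + d
        ≡⟨ cong (_+ + d) (trans (∑-combine n (ℕ.suc q) _) (∑-cong λ i → ∑-cong λ b → cong₂ _*_ (vector-combine (X j) i b) (vector-combine (X l) i b))) ⟨
      a j · a l + + d
        ≡⟨ cong (_+ + d) (a·b j l (j≢l ∘ sym)) ⟩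
      + (2 ℕ.* k) - + d + + d
        ≡⟨ id₁ (+ (2 ℕ.* k)) (+ d) ⟩
      + (2 ℕ.* k) ∎)
      where
      open ≡-Reasoning
      id₁ : ∀ x d → x - d + d ≡ x
      id₁ = solve-∀
      2≤m : 2 ℕ.≤ m
      2≤m = ℕ.≤-trans (ℕ.m≤n+m 2 (d ℕ.* d ℕ.+ d)) large
      j : Fin m
      j = fromℕ< 2≤m
      l : Fin m
      l = proj₁ (another j (+≤+ 2≤m))
      j≢l : j ≢ l
      j≢l = proj₂ (another j (+≤+ 2≤m)) ∘ sym

    -- Double counting of nonzero entries: each word has `k`, each kernel coordinate accounts for
    -- `m`, and every other coordinate for at most one. The kernel size is added on both sides to
    -- avoid subtraction.
    size-bound : m ℕ.* k ℕ.+ ∣ kernel ∣ ℕ.≤ n ℕ.+ m ℕ.* ∣ kernel ∣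
    size-bound = ℤ.drop‿+≤+ (from-diff _ (diff counting)
      (trans (cong₂ (λ u v → + n + u - (v + + ∣ kernel ∣)) (ℤ.pos-* m ∣ kernel ∣) (ℤ.pos-* m k)) (id₁ (+ n) (+ m) (+ k) (+ ∣ kernel ∣))))
      where
      id₁ : ∀ n m k D → n + m * D - (m * k + D) ≡ n * 1ℤ + (m - 1ℤ) * D - m * k
      id₁ = solve-∀
      id₂ : ∀ m → 1ℤ + (m - 1ℤ) * 0ℤ ≡ 1ℤ
      id₂ = solve-∀
      id₃ : ∀ m → m * 1ℤ ≡ 1ℤ + (m - 1ℤ) * 1ℤ
      id₃ = solve-∀
      column : ∀ i (f : Dec (Full i)) → (∑ λ j → nz j i) ≤ 1ℤ + (+ m - 1ℤ) * ⟦ f ⟧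
      column i (yes full) = subst ((∑ λ j → nz j i) ≤_) (trans (∑-const m 1ℤ) (id₃ (+ m)))
        (∑-mono-≤ λ j → ⟦⟧≤1 (nonzero? (lookup (X j) i)))
      column i (no ¬full) = subst ((∑ λ j → nz j i) ≤_) (sym (id₂ (+ m))) (sparse i ¬full)
      counting : + m * + k ≤ + n * 1ℤ + (+ m - 1ℤ) * + ∣ kernel ∣
      counting = begin
        + m * + k                                  ≡⟨ ∑-const m (+ k) ⟨
        (∑ {m} λ j → + k)                          ≡⟨ ∑-cong ∣supp∣ ⟨
        (∑ λ j → ∑ λ i → nz j i)                   ≡⟨ ∑-swap nz ⟩
        (∑ λ i → ∑ λ j → nz j i)                   ≤⟨ ∑-mono-≤ (λ i → column i (full? i)) ⟩
        (∑ λ i → 1ℤ + (+ m - 1ℤ) * ⟦ full? i ⟧)    ≡⟨ ∑-+ (λ _ → 1ℤ) (λ i → (+ m - 1ℤ) * ⟦ full? i ⟧) ⟩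
        (∑ {n} λ _ → 1ℤ) + (∑ λ i → (+ m - 1ℤ) * ⟦ full? i ⟧)
          ≡⟨ cong₂ _+_ (∑-const n 1ℤ) (trans (∑-*ˡ (+ m - 1ℤ) (λ i → ⟦ full? i ⟧)) (cong ((+ m - 1ℤ) *_) (sym ∣kernel∣))) ⟩
        + n * 1ℤ + (+ m - 1ℤ) * + ∣ kernel ∣       ∎
        where open ℤ.≤-Reasoning

import Data.Integer.Base as ℤ
import Data.Integer.Properties as ℤ
open import Data.Integer.Base using (ℤ; +_)
open import Data.Rational.Base using (ℚ; _/_; _+_; _-_; _*_; _÷_; _⊔_; _≤_; _>_; _<_; toℚᵘ; NonZero; Positive; 1/_)
import Data.Rational.Properties as ℚ
open import Data.Rational.Solver using (module +-*-Solver)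
open import Data.Rational.Unnormalised.Base using (mkℚᵘ; *≡*; *≤*; _≃_)
import Data.Rational.Unnormalised.Properties as ℚᵘ

open Vectors using (module LargeCode)

-- The parameters as rational numbers

toℚᵘ-ι : ∀ a → toℚᵘ (ι a) ≃ mkℚᵘ (+ a) 0
toℚᵘ-ι a = ℚ.toℚᵘ-fromℚᵘ (mkℚᵘ (+ a) 0)

ι-+ : ∀ a b → ι (a ℕ.+ b) ≡ ι a + ι b
ι-+ a b = ℚ.toℚᵘ-injective (ℚᵘ.≃-trans (toℚᵘ-ι (a ℕ.+ b)) (ℚᵘ.≃-trans
  (*≡* (cong (ℤ._* + 1) (sym (cong₂ ℤ._+_ (ℤ.*-identityʳ (+ a)) (ℤ.*-identityʳ (+ b))))))
  (ℚᵘ.≃-sym (ℚᵘ.≃-trans (ℚ.toℚᵘ-homo-+ (ι a) (ι b)) (ℚᵘ.+-cong (toℚᵘ-ι a) (toℚᵘ-ι b))))))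

ι-* : ∀ a b → ι (a ℕ.* b) ≡ ι a * ι b
ι-* a b = ℚ.toℚᵘ-injective (ℚᵘ.≃-trans (toℚᵘ-ι (a ℕ.* b)) (ℚᵘ.≃-trans
  (*≡* (cong (ℤ._* + 1) (ℤ.pos-* a b)))
  (ℚᵘ.≃-sym (ℚᵘ.≃-trans (ℚ.toℚᵘ-homo-* (ι a) (ι b)) (ℚᵘ.*-cong (toℚᵘ-ι a) (toℚᵘ-ι b))))))

ι-mono-≤ : ∀ {a b} → a ℕ.≤ b → ι a ≤ ι b
ι-mono-≤ {a} {b} a≤b = ℚ.toℚᵘ-cancel-≤ (ℚᵘ.≤-respˡ-≃ (ℚᵘ.≃-sym (toℚᵘ-ι a)) (ℚᵘ.≤-respʳ-≃ (ℚᵘ.≃-sym (toℚᵘ-ι b))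
  (*≤* (ℤ.*-monoʳ-≤-nonNeg (+ 1) (ℤ.+≤+ a≤b)))))

ι-cancel-< : ∀ {a b} → ι a < ι b → a ℕ.< b
ι-cancel-< {a} {b} a<b = ℤ.drop‿+<+ (subst₂ ℤ._<_ (ℤ.*-identityʳ (+ a)) (ℤ.*-identityʳ (+ b))
  (ℚᵘ.drop-*<* (ℚᵘ.<-respˡ-≃ (toℚᵘ-ι a) (ℚᵘ.<-respʳ-≃ (toℚᵘ-ι b) (ℚ.toℚᵘ-mono-< a<b)))))

double-half : ∀ d → + d / 2 + + d / 2 ≡ ι d
double-half d = ℚ.toℚᵘ-injective (ℚᵘ.≃-trans (ℚ.toℚᵘ-homo-+ (+ d / 2) (+ d / 2))
  (ℚᵘ.≃-trans (ℚᵘ.+-cong half half) (ℚᵘ.≃-trans (*≡* eq) (ℚᵘ.≃-sym (toℚᵘ-ι d)))))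
  where
  half : toℚᵘ (+ d / 2) ≃ mkℚᵘ (+ d) 1
  half = ℚ.toℚᵘ-fromℚᵘ (mkℚᵘ (+ d) 1)
  eq : (+ d ℤ.* + 2 ℤ.+ + d ℤ.* + 2) ℤ.* + 1 ≡ + d ℤ.* + 4
  eq = trans (ℤ.*-identityʳ _) (sym (ℤ.*-distribˡ-+ (+ d) (+ 2) (+ 2)))

half-injective : ∀ {c d} → + c / 2 ≡ + d / 2 → c ≡ d
half-injective {c} {d} eq = ℤ.+-injective (ℤ.*-cancelʳ-≡ (+ c) (+ d) (+ 2)
  (ℚᵘ.drop-*≡* (ℚ./-injective-≃ (mkℚᵘ (+ c) 1) (mkℚᵘ (+ d) 1) eq)))

half-double : ∀ e → + (2 ℕ.* e) / 2 ≡ ι e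
half-double e = ℚ.fromℚᵘ-cong {mkℚᵘ (+ (2 ℕ.* e)) 1} {mkℚᵘ (+ e) 0}
  (*≡* (trans (ℤ.*-identityʳ _) (trans (ℤ.pos-* 2 e) (ℤ.*-comm (+ 2) (+ e)))))

*-≤⇒≤-÷ : ∀ {p x} y .{{_ : NonZero y}} .{{_ : Positive y}} → p * y ≤ x → p ≤ x ÷ y
*-≤⇒≤-÷ {p} {x} y py≤x = ℚ.*-cancelʳ-≤-pos y (ℚ.≤-trans py≤x (ℚ.≤-reflexive (sym (begin
  x ÷ y * y         ≡⟨ ℚ.*-assoc x (1/ y) y ⟩
  x * (1/ y * y)    ≡⟨ cong (x *_) (ℚ.*-inverseˡ y) ⟩
  x * ι 1           ≡⟨ ℚ.*-identityʳ x ⟩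
  x                 ∎))))
  where open ≡-Reasoning

private
  bound-2l+2 : ∀ K h → ι 2 * (K - h) + ι 2 + (h + h) ≡ ι 2 * K + ι 2
  bound-2l+2 = solve 2 (λ K h → con (ι 2) :* (K :- h) :+ con (ι 2) :+ (h :+ h) := con (ι 2) :* K :+ con (ι 2)) refl
    where open +-*-Solver

  bound-d²+d+1 : ∀ K h → ι 4 * ((K - (K - h)) * (K - (K - h))) + ι 2 * (K - (K - h)) + ι 1 ≡
    (h + h) * (h + h) + (h + h) + ι 1
  bound-d²+d+1 = solve 2 (λ K h → con (ι 4) :* ((K :- (K :- h)) :* (K :- (K :- h))) :+ con (ι 2) :* (K :- (K :- h)) :+ con (ι 1)
    := (h :+ h) :* (h :+ h) :+ (h :+ h) :+ con (ι 1)) refl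
    where open +-*-Solver

  K-[K-h] : ∀ K h → K - (K - h) ≡ h
  K-[K-h] = solve 2 (λ K h → K :- (K :- h) := h) refl
    where open +-*-Solver

  x-y+y : ∀ x y → x - y + y ≡ x
  x-y+y = solve 2 (λ x y → x :- y :+ y := x) refl
    where open +-*-Solver

  x+y-y : ∀ x y → x + y - y ≡ x
  x+y-y = solve 2 (λ x y → x :+ y :- y := x) refl
    where open +-*-Solver

-- Translation of the rational hypotheses into natural numbers

module _ {k d m : ℕ} where

  -- Adding `d` to both sides clears the half, as `2 l + d` is `2 k`; strictness between integers
  -- turns 2 into 3.
  2k+3≤m+d : ι m > ι 2 * (ι k - + d / 2) + ι 2 → 2 ℕ.* k ℕ.+ 3 ℕ.≤ m ℕ.+ d
  2k+3≤m+d m> = subst (ℕ._≤ m ℕ.+ d) (sym (ℕ.+-suc (2 ℕ.* k) 2)) (ι-cancel-< (begin-strict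
    ι (2 ℕ.* k ℕ.+ 2)                   ≡⟨ ι-+ (2 ℕ.* k) 2 ⟩
    ι (2 ℕ.* k) + ι 2                   ≡⟨ cong (_+ ι 2) (ι-* 2 k) ⟩
    ι 2 * ι k + ι 2                     ≡⟨ bound-2l+2 (ι k) h ⟨
    ι 2 * (ι k - h) + ι 2 + (h + h)     ≡⟨ cong (λ z → ι 2 * (ι k - h) + ι 2 + z) (double-half d) ⟩
    ι 2 * (ι k - h) + ι 2 + ι d         <⟨ ℚ.+-monoˡ-< (ι d) m> ⟩
    ι m + ι d                    ≡⟨ ι-+ m d ⟨
    ι (m ℕ.+ d)                    ∎))
    where
    open ℚ.≤-Reasoning
    h = + d / 2

  -- Here `2 (k - l)` is `d`, so the bound is `d² + d + 1`, and strictness adds 1.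
  d²+d+2≤m : (let l = ι k - + d / 2) → ι m > ι 4 * ((ι k - l) * (ι k - l)) + ι 2 * (ι k - l) + ι 1 →
    d ℕ.* d ℕ.+ d ℕ.+ 2 ℕ.≤ m
  d²+d+2≤m m> = subst (ℕ._≤ m) (sym (ℕ.+-suc (d ℕ.* d ℕ.+ d) 1)) (ι-cancel-< (begin-strict
    ι (d ℕ.* d ℕ.+ d ℕ.+ 1)             ≡⟨ ι-+ (d ℕ.* d ℕ.+ d) 1 ⟩
    ι (d ℕ.* d ℕ.+ d) + ι 1             ≡⟨ cong (_+ ι 1) (ι-+ (d ℕ.* d) d) ⟩
    ι (d ℕ.* d) + ι d + ι 1             ≡⟨ cong (λ z → z + ι d + ι 1) (ι-* d d) ⟩
    ι d * ι d + ι d + ι 1               ≡⟨ cong (λ z → z * z + z + ι 1) (double-half d) ⟨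
    (h + h) * (h + h) + (h + h) + ι 1   ≡⟨ bound-d²+d+1 (ι k) h ⟨
    ι 4 * ((ι k - (ι k - h)) * (ι k - (ι k - h))) + ι 2 * (ι k - (ι k - h)) + ι 1 <⟨ m> ⟩
    ι m                          ∎))
    where
    open ℚ.≤-Reasoning
    h = + d / 2

  q≤m : ∀ q → ι m > ι q - ι 1 → q ℕ.≤ m
  q≤m q m> = ℕ.s≤s⁻¹ (subst (q ℕ.<_) (ℕ.+-comm m 1)
    (ι-cancel-< (subst₂ _<_ (x-y+y (ι q) (ι 1)) (sym (ι-+ m 1)) (ℚ.+-monoˡ-< (ι 1) m>))))

-- The witness `e` is the number of nonzero coordinates of a word outside a kernel of size `D`; two
-- disjoint petals of this size account for the distance.
petal-size : ∀ D k d → 2 ℕ.* D ℕ.+ d ≡ 2 ℕ.* k → ∃[ e ] k ≡ D ℕ.+ e × d ≡ 2 ℕ.* e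
petal-size D k d eq = k ℕ.∸ D , sym k≡ , ℕ.+-cancelˡ-≡ (2 ℕ.* D) d (2 ℕ.* (k ℕ.∸ D))
  (trans eq (trans (cong (2 ℕ.*_) (sym k≡)) (ℕ.*-distribˡ-+ 2 D (k ℕ.∸ D))))
  where
  D≤k : D ℕ.≤ k
  D≤k = ℕ.*-cancelˡ-≤ 2 (subst (2 ℕ.* D ℕ.≤_) eq (ℕ.m≤m+n (2 ℕ.* D) d))
  k≡ : D ℕ.+ (k ℕ.∸ D) ≡ k
  k≡ = ℕ.m+[n∸m]≡n D≤k

theorem10 : (q n k : ℕ) → 2 ℕ.≤ q → 1 ℕ.≤ k → k ℕ.≤ n →
    (d : ℕ) (0<d : 0 ℕ.< d) → d ℕ.≤ 2 ℕ.* k →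
    (l : ℚ) (l≡k-d/2 : l ≡ ι k - + d / 2) →
    (F : Code q n) → IsFamily q n k l F →
    ι (size F) >
    (ι 2 * l + ι 2)
    ⊔ (ι 4 * ((ι k - l) * (ι k - l)) + ι 2 * (ι k - l) + ι 1)
    ⊔ (ι q - ι 1) →
    (∃[ m ] l ≡ m / 1)
    × IsΔ-System q n k l F
    × ι (size F) ≤ ((ι n - l) ÷ (ι k - l)) {{k-l-nonZero k d l 0<d l≡k-d/2}}
theorem10 (ℕ.suc q) n k 2≤q 1≤k k≤n d 0<d d≤2k l refl F (weight , d′ , l≡ , equidistant) m>max =
  (+ ∣ kernel ∣ , l≡D) , ((λ {x} → weight {x}) , kernel , sym l≡D , kernel-constant , petals-disjoint) ,
  *-≤⇒≤-÷ (ι k - (ι k - h)) {{k-l-nonZero k d _ 0<d refl}} {{pos}} (begin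
    ι m * (ι k - (ι k - h))       ≡⟨ cong (ι m *_) (trans (K-[K-h] (ι k) h) h≡e) ⟩
    ι m * ι e                     ≡⟨ ι-* m e ⟨
    ι (m ℕ.* e)                   ≡⟨ x+y-y (ι (m ℕ.* e)) (ι D) ⟨
    ι (m ℕ.* e) + ι D - ι D       ≡⟨ cong (_- ι D) (ι-+ (m ℕ.* e) D) ⟨
    ι (m ℕ.* e ℕ.+ D) - ι D       ≤⟨ ℚ.+-monoˡ-≤ _ (ι-mono-≤ counting) ⟩
    ι n - ι D                     ≡⟨ cong (λ z → ι n - z) l≡D ⟨
    ι n - (ι k - h)               ∎)
  where
  open ℚ.≤-Reasoning
  m = size F
  h = + d / 2
  A = ι 2 * (ι k - h) + ι 2
  B = ι 4 * ((ι k - (ι k - h)) * (ι k - (ι k - h))) + ι 2 * (ι k - (ι k - h)) + ι 1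
  C = ι (ℕ.suc q) - ι 1

  -- The family comes with a distance of its own, but both distances determine the same `l`.
  d′≡d : d′ ≡ d
  d′≡d = half-injective (trans (sym (K-[K-h] (ι k) (+ d′ / 2))) (trans (cong (λ z → ι k - z) (sym l≡)) (K-[K-h] (ι k) h)))

  open LargeCode F k d (λ {x} → weight {x}) (λ x∈F y∈F x≢y → trans (equidistant x∈F y∈F x≢y) d′≡d) 0<d d≤2k
    (d²+d+2≤m {k} {d} (ℚ.≤-<-trans (ℚ.≤-trans (ℚ.p≤q⊔p A B) (ℚ.p≤p⊔q (A ⊔ B) C)) m>max))
    (2k+3≤m+d {k} {d} (ℚ.≤-<-trans (ℚ.≤-trans (ℚ.p≤p⊔q A B) (ℚ.p≤p⊔q (A ⊔ B) C)) m>max))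
    (q≤m {k} {d} (ℕ.suc q) (ℚ.≤-<-trans (ℚ.p≤q⊔p (A ⊔ B) C) m>max))

  D = ∣ kernel ∣

  petal : ∃[ e ] k ≡ D ℕ.+ e × d ≡ 2 ℕ.* e
  petal = petal-size D k d kernel-size

  e : ℕ
  e = proj₁ petal

  k≡D+e : k ≡ D ℕ.+ e
  k≡D+e = proj₁ (proj₂ petal)

  h≡e : h ≡ ι e
  h≡e = trans (cong (λ z → + z / 2) (proj₂ (proj₂ petal))) (half-double e)

  l≡D : ι k - h ≡ ι D
  l≡D = trans (cong₂ _-_ (trans (cong ι k≡D+e) (ι-+ D e)) h≡e) (x+y-y (ι D) (ι e))

  pos : Positive (ι k - (ι k - h))
  pos = subst Positive (sym (K-[K-h] (ι k) h)) (ℚ.normalize-pos d 2 {{_}} {{ℕ.>-nonZero 0<d}})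

  -- Substituting `D ℕ.+ e` for `k` in `size-bound` lets `m ℕ.* D` cancel. This is the claimed bound
  -- with the denominator `k - l` cleared and `l` moved to the left.
  counting : m ℕ.* e ℕ.+ D ℕ.≤ n
  counting = ℕ.+-cancelʳ-≤ (m ℕ.* D) (m ℕ.* e ℕ.+ D) n (subst (ℕ._≤ n ℕ.+ m ℕ.* D) eq size-bound)
    where
    eq : m ℕ.* k ℕ.+ D ≡ m ℕ.* e ℕ.+ D ℕ.+ m ℕ.* D
    eq = trans (cong (λ z → m ℕ.* z ℕ.+ D) k≡D+e) (trans (cong (ℕ._+ D) (ℕ.*-distribˡ-+ m D e))
      (trans (ℕ.+-assoc (m ℕ.* D) (m ℕ.* e) D) (ℕ.+-comm (m ℕ.* D) (m ℕ.* e ℕ.+ D))))
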